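{- Let $P(X)\in\mathbb{Z}[X]$ be a polynomial of degree $d$, and assume $d\ge 2$. If $\tau>d+1$, then $$W_{\tau}(P_{\alpha})=\emptyset$$ for almost all $\alpha\in\mathbb{R}$ (with respect to Lebesgue measure).
   Context: For a real number $\alpha$ and $\tau>0$, $W_{\tau}(P_{\alpha})$ denotes the set of all $x\in\mathbb{R}$ such that $$\left|x-\frac{p}{q}\right|<\frac{1}{q^{\tau}}\quad\text{and}\quad\left|P(x)+\alpha-\frac{r}{q}\right|<\frac{1}{q^{\tau}}$$ for infinitely many triples of integers $(p,r,q)$ with $q\ge 1$. "Almost all" means that the set of exceptions has Lebesgue measure zero. -}

module Defs where

open import Data.Empty using (⊥)
open import Data.Integer as ℤ using (ℤ; +_; -[1+_])
import Data.Integer.Properties as ℤ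
import Data.Integer.Solver as ℤSolver
open import Data.List using (List)
open import Data.List.Membership.Propositional using (_∉_)
open import Data.Nat as ℕ using (ℕ; zero; suc; NonZero)
import Data.Nat.Properties as ℕ
import Data.Nat.Solver as ℕSolver
open import Data.Product using (∃-syntax; Σ-syntax; _×_; _,_; proj₁; proj₂)
open import Data.Rational as ℚ using (ℚ; 0ℚ; 1ℚ; ½; _/_; ↥_; ↧_; ↧ₙ_)
import Data.Rational.Properties as ℚ
import Data.Rational.Solver as ℚSolver
open import Data.Rational.Unnormalised as ℚᵘ using (mkℚᵘ)
import Data.Rational.Unnormalised.Properties as ℚᵘ
open import Data.Sum using (inj₁; inj₂)
open import Data.Vec using (Vec; []; _∷_; last)
open import Level using (0ℓ)
open import Relation.Binary.PropositionalEquality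
open import Relation.Nullary using (¬_; yes; no)
open import Relation.Unary using (Pred)

------------------------------------------------------------------------
-- Auxiliary facts about ℚ

half+half : ∀ ε → ½ ℚ.* ε ℚ.+ ½ ℚ.* ε ≡ ε
half+half ε = trans (sym (ℚ.*-distribʳ-+ ε ½ ½)) (ℚ.*-identityˡ ε)

0<p*q : ∀ {p q} → 0ℚ ℚ.< p → 0ℚ ℚ.< q → 0ℚ ℚ.< p ℚ.* q
0<p*q {p} {q} 0<p 0<q =
  ℚ.positive⁻¹ _ {{ℚ.pos*pos⇒pos p {{ℚ.positive 0<p}} q {{ℚ.positive 0<q}}}}

half-pos : ∀ {ε} → 0ℚ ℚ.< ε → 0ℚ ℚ.< ½ ℚ.* ε
half-pos = 0<p*q (ℚ.positive⁻¹ ½)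

∣p-q∣≡∣q-p∣ : ∀ p q → ℚ.∣ p ℚ.- q ∣ ≡ ℚ.∣ q ℚ.- p ∣
∣p-q∣≡∣q-p∣ p q = trans (sym (ℚ.∣-p∣≡∣p∣ (p ℚ.- q)))
  (cong ℚ.∣_∣ (solve 2 (λ a b → :- (a :- b) := b :- a) refl p q))
  where open ℚSolver.+-*-Solver

p≤∣p∣ : ∀ p → p ℚ.≤ ℚ.∣ p ∣
p≤∣p∣ p with ℚ.≤-total 0ℚ p
... | inj₁ 0≤p = ℚ.≤-reflexive (sym (ℚ.0≤p⇒∣p∣≡p 0≤p))
... | inj₂ p≤0 = ℚ.≤-trans p≤0 (ℚ.0≤∣p∣ p)

p≤q+∣p-q∣ : ∀ p q → p ℚ.≤ q ℚ.+ ℚ.∣ p ℚ.- q ∣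
p≤q+∣p-q∣ p q = begin
  p                           ≡⟨ solve 2 (λ a b → a := b :+ (a :- b)) refl p q ⟩
  q ℚ.+ (p ℚ.- q)             ≤⟨ ℚ.+-monoʳ-≤ q (p≤∣p∣ (p ℚ.- q)) ⟩
  q ℚ.+ ℚ.∣ p ℚ.- q ∣         ∎
  where open ℚ.≤-Reasoning
        open ℚSolver.+-*-Solver

∣p∣≤∣p-q∣+∣q∣ : ∀ p q → ℚ.∣ p ∣ ℚ.≤ ℚ.∣ p ℚ.- q ∣ ℚ.+ ℚ.∣ q ∣
∣p∣≤∣p-q∣+∣q∣ p q = begin
  ℚ.∣ p ∣                       ≡⟨ cong ℚ.∣_∣ (solve 2 (λ a b → a := (a :- b) :+ b) refl p q) ⟩
  ℚ.∣ (p ℚ.- q) ℚ.+ q ∣         ≤⟨ ℚ.∣p+q∣≤∣p∣+∣q∣ (p ℚ.- q) q ⟩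
  ℚ.∣ p ℚ.- q ∣ ℚ.+ ℚ.∣ q ∣     ∎
  where open ℚ.≤-Reasoning
        open ℚSolver.+-*-Solver

∣∣p∣-∣q∣∣≤∣p-q∣ : ∀ p q → ℚ.∣ ℚ.∣ p ∣ ℚ.- ℚ.∣ q ∣ ∣ ℚ.≤ ℚ.∣ p ℚ.- q ∣
∣∣p∣-∣q∣∣≤∣p-q∣ p q with ℚ.∣p∣≡p∨∣p∣≡-p (ℚ.∣ p ∣ ℚ.- ℚ.∣ q ∣)
... | inj₁ eq = begin
  ℚ.∣ ℚ.∣ p ∣ ℚ.- ℚ.∣ q ∣ ∣                   ≡⟨ eq ⟩
  ℚ.∣ p ∣ ℚ.- ℚ.∣ q ∣                         ≤⟨ ℚ.+-monoˡ-≤ (ℚ.- ℚ.∣ q ∣) (∣p∣≤∣p-q∣+∣q∣ p q) ⟩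
  (ℚ.∣ p ℚ.- q ∣ ℚ.+ ℚ.∣ q ∣) ℚ.- ℚ.∣ q ∣     ≡⟨ solve 2 (λ a b → (a :+ b) :- b := a) refl ℚ.∣ p ℚ.- q ∣ ℚ.∣ q ∣ ⟩
  ℚ.∣ p ℚ.- q ∣                               ∎
  where open ℚ.≤-Reasoning
        open ℚSolver.+-*-Solver
... | inj₂ eq = begin
  ℚ.∣ ℚ.∣ p ∣ ℚ.- ℚ.∣ q ∣ ∣                   ≡⟨ eq ⟩
  ℚ.- (ℚ.∣ p ∣ ℚ.- ℚ.∣ q ∣)                   ≡⟨ solve 2 (λ a b → :- (a :- b) := b :- a) refl ℚ.∣ p ∣ ℚ.∣ q ∣ ⟩
  ℚ.∣ q ∣ ℚ.- ℚ.∣ p ∣                         ≤⟨ ℚ.+-monoˡ-≤ (ℚ.- ℚ.∣ p ∣) (∣p∣≤∣p-q∣+∣q∣ q p) ⟩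
  (ℚ.∣ q ℚ.- p ∣ ℚ.+ ℚ.∣ p ∣) ℚ.- ℚ.∣ p ∣     ≡⟨ solve 2 (λ a b → (a :+ b) :- b := a) refl ℚ.∣ q ℚ.- p ∣ ℚ.∣ p ∣ ⟩
  ℚ.∣ q ℚ.- p ∣                               ≡⟨ ∣p-q∣≡∣q-p∣ q p ⟩
  ℚ.∣ p ℚ.- q ∣                               ∎
  where open ℚ.≤-Reasoning
        open ℚSolver.+-*-Solver

∣p-q∣<ε : ∀ {p q ε} → p ℚ.< q ℚ.+ ε → q ℚ.< p ℚ.+ ε → ℚ.∣ p ℚ.- q ∣ ℚ.< ε
∣p-q∣<ε {p} {q} {ε} p<q+ε q<p+ε with ℚ.∣p∣≡p∨∣p∣≡-p (p ℚ.- q)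
... | inj₁ eq = begin-strict
  ℚ.∣ p ℚ.- q ∣          ≡⟨ eq ⟩
  p ℚ.- q                <⟨ ℚ.+-monoˡ-< (ℚ.- q) p<q+ε ⟩
  (q ℚ.+ ε) ℚ.- q        ≡⟨ solve 2 (λ a e → (a :+ e) :- a := e) refl q ε ⟩
  ε                      ∎
  where open ℚ.≤-Reasoning
        open ℚSolver.+-*-Solver
... | inj₂ eq = begin-strict
  ℚ.∣ p ℚ.- q ∣          ≡⟨ eq ⟩
  ℚ.- (p ℚ.- q)          ≡⟨ solve 2 (λ a b → :- (a :- b) := b :- a) refl p q ⟩
  q ℚ.- p                <⟨ ℚ.+-monoˡ-< (ℚ.- p) q<p+ε ⟩
  (p ℚ.+ ε) ℚ.- p        ≡⟨ solve 2 (λ a e → (a :+ e) :- a := e) refl p ε ⟩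
  ε                      ∎
  where open ℚ.≤-Reasoning
        open ℚSolver.+-*-Solver

toℚᵘ-/ : ∀ i n → ℚ.toℚᵘ (i / suc n) ℚᵘ.≃ mkℚᵘ i n
toℚᵘ-/ i n = ℚ.toℚᵘ-fromℚᵘ (mkℚᵘ i n)

-- k / m ≤ k′ / m′ + 1 / m′ + 1 / t, with cleared denominators.
fraction-≤ : ∀ k m k′ m′ t →
  k ℕ.* (suc m′ ℕ.* suc t) ℕ.≤ (k′ ℕ.* suc t ℕ.+ suc t ℕ.+ suc m′) ℕ.* suc m →
  + k / suc m ℚ.≤ + k′ / suc m′ ℚ.+ (+ 1 / suc m′ ℚ.+ + 1 / suc t)
fraction-≤ k m k′ m′ t h = ℚ.toℚᵘ-cancel-≤
  (ℚᵘ.≤-respˡ-≃ (ℚᵘ.≃-sym (toℚᵘ-/ (+ k) m))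
  (ℚᵘ.≤-respʳ-≃ (ℚᵘ.≃-sym rhs) core))
  where
  s : ℚᵘ.ℚᵘ
  s = mkℚᵘ (+ (k′ ℕ.* suc t ℕ.+ suc t ℕ.+ suc m′)) (t ℕ.+ m′ ℕ.* suc t)

  rhs : ℚ.toℚᵘ (+ k′ / suc m′ ℚ.+ (+ 1 / suc m′ ℚ.+ + 1 / suc t)) ℚᵘ.≃ s
  rhs = ℚᵘ.≃-trans (ℚ.toℚᵘ-homo-+ (+ k′ / suc m′) (+ 1 / suc m′ ℚ.+ + 1 / suc t))
       (ℚᵘ.≃-trans (ℚᵘ.+-cong (toℚᵘ-/ (+ k′) m′)
          (ℚᵘ.≃-trans (ℚ.toℚᵘ-homo-+ (+ 1 / suc m′) (+ 1 / suc t))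
            (ℚᵘ.+-cong (toℚᵘ-/ (+ 1) m′) (toℚᵘ-/ (+ 1) t))))
       (ℚᵘ.*≡* eq))
    where
    open ℤSolver.+-*-Solver
    K M T : ℤ
    K = + k′
    M = + suc m′
    T = + suc t
    num : + (k′ ℕ.* suc t ℕ.+ suc t ℕ.+ suc m′) ≡ (K ℤ.* T ℤ.+ T) ℤ.+ M
    num = trans (ℤ.pos-+ (k′ ℕ.* suc t ℕ.+ suc t) (suc m′))
          (cong (ℤ._+ M) (trans (ℤ.pos-+ (k′ ℕ.* suc t) (suc t))
                                (cong (ℤ._+ T) (ℤ.pos-* k′ (suc t)))))
    eq : (K ℤ.* (M ℤ.* T) ℤ.+ (+ 1 ℤ.* T ℤ.+ + 1 ℤ.* M) ℤ.* M) ℤ.* (M ℤ.* T)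
       ≡ + (k′ ℕ.* suc t ℕ.+ suc t ℕ.+ suc m′) ℤ.* (M ℤ.* (M ℤ.* T))
    eq = trans
      (solve 3 (λ a b c →
         (a :* (b :* c) :+ (con (+ 1) :* c :+ con (+ 1) :* b) :* b) :* (b :* c)
         := (a :* c :+ c :+ b) :* (b :* (b :* c))) refl K M T)
      (cong (ℤ._* (M ℤ.* (M ℤ.* T))) (sym num))

  core : mkℚᵘ (+ k) m ℚᵘ.≤ s
  core = ℚᵘ.*≤* (subst₂ ℤ._≤_
    (ℤ.pos-* k (suc m′ ℕ.* suc t))
    (ℤ.pos-* (k′ ℕ.* suc t ℕ.+ suc t ℕ.+ suc m′) (suc m))
    (ℤ.+≤+ h))

1/-small : ∀ {ε} → 0ℚ ℚ.< ε → ∀ n → ↧ₙ ε ℕ.≤ n → + 1 / suc n ℚ.< ε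
1/-small {ε@record{}} 0<ε n d≤n = ℚ.toℚᵘ-cancel-<
  (ℚᵘ.<-respˡ-≃ (ℚᵘ.≃-sym (toℚᵘ-/ (+ 1) n)) (ℚᵘ.*<* (go (↥ ε) (ℚ.positive 0<ε))))
  where
  go : ∀ i → ℤ.Positive i → + 1 ℤ.* ↧ ε ℤ.< i ℤ.* + suc n
  go (+ suc i) _ = ℤ.≤-<-trans (ℤ.≤-reflexive (ℤ.*-identityˡ (↧ ε)))
    (ℤ.+<+ (ℕ.<-≤-trans (ℕ.s≤s d≤n) (ℕ.m≤m+n (suc n) (i ℕ.* suc n))))

------------------------------------------------------------------------
-- Real numbers

-- Two sequences denote the same real when their difference tends to 0;
-- the order and the operations below are invariant under this.
record ℝ : Set where
  constructor mkℝ
  field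
    seq    : ℕ → ℚ
    cauchy : ∀ ε → 0ℚ ℚ.< ε →
             ∃[ N ] ∀ m n → N ℕ.≤ m → N ℕ.≤ n → ℚ.∣ seq m ℚ.- seq n ∣ ℚ.< ε

open ℝ public

infix  4 _<ᴿ_
infixl 6 _+ᴿ_ _-ᴿ_
infixl 7 _*ᴿ_
infix  8 -ᴿ_
infixr 9 _^ᴿ_

_<ᴿ_ : ℝ → ℝ → Set
x <ᴿ y = ∃[ ε ] 0ℚ ℚ.< ε × ∃[ N ] ∀ n → N ℕ.≤ n → seq x n ℚ.+ ε ℚ.≤ seq y n

ι : ℚ → ℝ
ι p = mkℝ (λ _ → p) λ ε 0<ε → 0 , λ _ _ _ _ →
  subst (ℚ._< ε) (sym (cong ℚ.∣_∣ (ℚ.+-inverseʳ p))) 0<ε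

-ᴿ_ : ℝ → ℝ
-ᴿ x = mkℝ (λ n → ℚ.- seq x n) λ ε 0<ε →
  let N , c = cauchy x ε 0<ε in
  N , λ m n N≤m N≤n → subst (ℚ._< ε) (lemma (seq x m) (seq x n)) (c m n N≤m N≤n)
  where
  open ℚSolver.+-*-Solver
  lemma : ∀ p q → ℚ.∣ p ℚ.- q ∣ ≡ ℚ.∣ ℚ.- p ℚ.- ℚ.- q ∣
  lemma p q = trans (∣p-q∣≡∣q-p∣ p q)
    (cong ℚ.∣_∣ (solve 2 (λ a b → b :- a := :- a :- :- b) refl p q))

∣_∣ᴿ : ℝ → ℝ
∣ x ∣ᴿ = mkℝ (λ n → ℚ.∣ seq x n ∣) λ ε 0<ε →
  let N , c = cauchy x ε 0<ε in
  N , λ m n N≤m N≤n → ℚ.≤-<-trans (∣∣p∣-∣q∣∣≤∣p-q∣ (seq x m) (seq x n)) (c m n N≤m N≤n)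

_+ᴿ_ : ℝ → ℝ → ℝ
x +ᴿ y = mkℝ (λ n → seq x n ℚ.+ seq y n) λ ε 0<ε →
  let N , c = cauchy x (½ ℚ.* ε) (half-pos 0<ε)
      M , d = cauchy y (½ ℚ.* ε) (half-pos 0<ε)
  in N ℕ.⊔ M , λ m n h k →
       bound ε (seq x m) (seq y m) (seq x n) (seq y n)
         (c m n (ℕ.m⊔n≤o⇒m≤o N M h) (ℕ.m⊔n≤o⇒m≤o N M k))
         (d m n (ℕ.m⊔n≤o⇒n≤o N M h) (ℕ.m⊔n≤o⇒n≤o N M k))
  where
  open ℚ.≤-Reasoning
  open ℚSolver.+-*-Solver
  bound : ∀ ε p q r s → ℚ.∣ p ℚ.- r ∣ ℚ.< ½ ℚ.* ε → ℚ.∣ q ℚ.- s ∣ ℚ.< ½ ℚ.* ε →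
          ℚ.∣ (p ℚ.+ q) ℚ.- (r ℚ.+ s) ∣ ℚ.< ε
  bound ε p q r s h k = begin-strict
    ℚ.∣ (p ℚ.+ q) ℚ.- (r ℚ.+ s) ∣
      ≡⟨ cong ℚ.∣_∣ (solve 4 (λ a b c d → (a :+ b) :- (c :+ d) := (a :- c) :+ (b :- d)) refl p q r s) ⟩
    ℚ.∣ (p ℚ.- r) ℚ.+ (q ℚ.- s) ∣          ≤⟨ ℚ.∣p+q∣≤∣p∣+∣q∣ (p ℚ.- r) (q ℚ.- s) ⟩
    ℚ.∣ p ℚ.- r ∣ ℚ.+ ℚ.∣ q ℚ.- s ∣        <⟨ ℚ.+-mono-< h k ⟩
    ½ ℚ.* ε ℚ.+ ½ ℚ.* ε                    ≡⟨ half+half ε ⟩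
    ε                                      ∎

_-ᴿ_ : ℝ → ℝ → ℝ
x -ᴿ y = x +ᴿ (-ᴿ y)

eventually-bounded : ∀ x → ∃[ B ] 0ℚ ℚ.< B × ∃[ N ] ∀ n → N ℕ.≤ n → ℚ.∣ seq x n ∣ ℚ.≤ B
eventually-bounded x =
  let N , c = cauchy x 1ℚ (ℚ.positive⁻¹ 1ℚ) in
  1ℚ ℚ.+ ℚ.∣ seq x N ∣ ,
  ℚ.<-≤-trans (ℚ.positive⁻¹ 1ℚ)
    (ℚ.≤-trans (ℚ.≤-reflexive (sym (ℚ.+-identityʳ 1ℚ))) (ℚ.+-monoʳ-≤ 1ℚ (ℚ.0≤∣p∣ (seq x N)))) ,
  N , λ n N≤n → ℚ.≤-trans (∣p∣≤∣p-q∣+∣q∣ (seq x n) (seq x N))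
    (ℚ.+-monoˡ-≤ ℚ.∣ seq x N ∣ (ℚ.<⇒≤ (c n N N≤n ℕ.≤-refl)))

_*ᴿ_ : ℝ → ℝ → ℝ
x *ᴿ y = mkℝ (λ n → seq x n ℚ.* seq y n) λ ε 0<ε →
  let A , 0<A , N₁ , a = eventually-bounded x
      B , 0<B , N₂ , b = eventually-bounded y
      N₃ , c = cauchy x (δ ε B 0<B) (δ-pos ε B 0<ε 0<B)
      N₄ , d = cauchy y (δ ε A 0<A) (δ-pos ε A 0<ε 0<A)
      L₁ = N₁ ℕ.⊔ N₂
      L₂ = N₃ ℕ.⊔ N₄
  in L₁ ℕ.⊔ L₂ , λ m n h k →
    let h₁ = ℕ.m⊔n≤o⇒m≤o L₁ L₂ h
        h₂ = ℕ.m⊔n≤o⇒n≤o L₁ L₂ h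
        k₁ = ℕ.m⊔n≤o⇒m≤o L₁ L₂ k
        k₂ = ℕ.m⊔n≤o⇒n≤o L₁ L₂ k
    in bound ε A B 0<A 0<B (seq x m) (seq y m) (seq x n) (seq y n)
         (a m (ℕ.m⊔n≤o⇒m≤o N₁ N₂ h₁)) (b n (ℕ.m⊔n≤o⇒n≤o N₁ N₂ k₁))
         (c m n (ℕ.m⊔n≤o⇒m≤o N₃ N₄ h₂) (ℕ.m⊔n≤o⇒m≤o N₃ N₄ k₂))
         (d m n (ℕ.m⊔n≤o⇒n≤o N₃ N₄ h₂) (ℕ.m⊔n≤o⇒n≤o N₃ N₄ k₂))
  where
  open ℚ.≤-Reasoning
  open ℚSolver.+-*-Solver

  inv : ∀ B → 0ℚ ℚ.< B → ℚ
  inv B 0<B = (ℚ.1/ B) {{ℚ.>-nonZero 0<B}}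

  δ : ∀ ε B → 0ℚ ℚ.< B → ℚ
  δ ε B 0<B = inv B 0<B ℚ.* (½ ℚ.* ε)

  δ-pos : ∀ ε B → 0ℚ ℚ.< ε → (0<B : 0ℚ ℚ.< B) → 0ℚ ℚ.< δ ε B 0<B
  δ-pos ε B 0<ε 0<B =
    0<p*q (ℚ.positive⁻¹ (inv B 0<B) {{ℚ.1/pos⇒pos B {{ℚ.positive 0<B}}}}) (half-pos 0<ε)

  term : ∀ ε B (0<B : 0ℚ ℚ.< B) p r → ℚ.∣ p ∣ ℚ.≤ B → ℚ.∣ r ∣ ℚ.< δ ε B 0<B →
         ℚ.∣ p ∣ ℚ.* ℚ.∣ r ∣ ℚ.< ½ ℚ.* ε
  term ε B 0<B p r p≤B r<δ = begin-strict
    ℚ.∣ p ∣ ℚ.* ℚ.∣ r ∣             ≤⟨ ℚ.*-monoʳ-≤-nonNeg ℚ.∣ r ∣ {{ℚ.∣-∣-nonNeg r}} p≤B ⟩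
    B ℚ.* ℚ.∣ r ∣                   <⟨ ℚ.*-monoʳ-<-pos B {{ℚ.positive 0<B}} r<δ ⟩
    B ℚ.* (inv B 0<B ℚ.* (½ ℚ.* ε)) ≡⟨ sym (ℚ.*-assoc B (inv B 0<B) (½ ℚ.* ε)) ⟩
    (B ℚ.* inv B 0<B) ℚ.* (½ ℚ.* ε) ≡⟨ cong (ℚ._* (½ ℚ.* ε)) (ℚ.*-inverseʳ B {{ℚ.>-nonZero 0<B}}) ⟩
    1ℚ ℚ.* (½ ℚ.* ε)                ≡⟨ ℚ.*-identityˡ (½ ℚ.* ε) ⟩
    ½ ℚ.* ε                         ∎

  bound : ∀ ε A B (0<A : 0ℚ ℚ.< A) (0<B : 0ℚ ℚ.< B) p q r s →
          ℚ.∣ p ∣ ℚ.≤ A → ℚ.∣ s ∣ ℚ.≤ B →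
          ℚ.∣ p ℚ.- r ∣ ℚ.< δ ε B 0<B → ℚ.∣ q ℚ.- s ∣ ℚ.< δ ε A 0<A →
          ℚ.∣ p ℚ.* q ℚ.- r ℚ.* s ∣ ℚ.< ε
  bound ε A B 0<A 0<B p q r s p≤A s≤B pr qs = begin-strict
    ℚ.∣ p ℚ.* q ℚ.- r ℚ.* s ∣
      ≡⟨ cong ℚ.∣_∣ (solve 4 (λ a b c d → a :* b :- c :* d := a :* (b :- d) :+ d :* (a :- c)) refl p q r s) ⟩
    ℚ.∣ p ℚ.* (q ℚ.- s) ℚ.+ s ℚ.* (p ℚ.- r) ∣
      ≤⟨ ℚ.∣p+q∣≤∣p∣+∣q∣ (p ℚ.* (q ℚ.- s)) (s ℚ.* (p ℚ.- r)) ⟩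
    ℚ.∣ p ℚ.* (q ℚ.- s) ∣ ℚ.+ ℚ.∣ s ℚ.* (p ℚ.- r) ∣
      ≡⟨ cong₂ ℚ._+_ (ℚ.∣p*q∣≡∣p∣*∣q∣ p (q ℚ.- s)) (ℚ.∣p*q∣≡∣p∣*∣q∣ s (p ℚ.- r)) ⟩
    ℚ.∣ p ∣ ℚ.* ℚ.∣ q ℚ.- s ∣ ℚ.+ ℚ.∣ s ∣ ℚ.* ℚ.∣ p ℚ.- r ∣
      <⟨ ℚ.+-mono-< (term ε A 0<A p (q ℚ.- s) p≤A qs) (term ε B 0<B s (p ℚ.- r) s≤B pr) ⟩
    ½ ℚ.* ε ℚ.+ ½ ℚ.* ε
      ≡⟨ half+half ε ⟩
    ε ∎

------------------------------------------------------------------------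
-- Real powers of positive integers

pos neg : ℤ → ℕ
pos (+ n)    = n
pos -[1+ n ] = 0
neg (+ n)    = 0
neg -[1+ n ] = suc n

-- With r = a / b, this says k / m ≤ q ^ r, i.e. (k / m) ^ b ≤ q ^ a.
BelowPower : ℕ → ℚ → ℕ → ℕ → Set
BelowPower q r m k =
  k ℕ.^ (↧ₙ r) ℕ.* q ℕ.^ neg (↥ r) ℕ.≤ q ℕ.^ pos (↥ r) ℕ.* m ℕ.^ (↧ₙ r)

largest : ℕ → ℚ → ℕ → ℕ → ℕ
largest q r m zero    = zero
largest q r m (suc B)
  with suc B ℕ.^ (↧ₙ r) ℕ.* q ℕ.^ neg (↥ r) ℕ.≤? q ℕ.^ pos (↥ r) ℕ.* m ℕ.^ (↧ₙ r)
... | yes _ = suc B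
... | no  _ = largest q r m B

-- ⌊ m q ^ r ⌋; every k with k / m ≤ q ^ r is at most q ^ pos (↥ r) * m.
scaledPower : ℕ → ℚ → ℕ → ℕ
scaledPower q r m = largest q r m (q ℕ.^ pos (↥ r) ℕ.* m)

*-^-distrib : ∀ m n o → (m ℕ.* n) ℕ.^ o ≡ m ℕ.^ o ℕ.* n ℕ.^ o
*-^-distrib m n zero    = refl
*-^-distrib m n (suc o) = trans (cong ((m ℕ.* n) ℕ.*_) (*-^-distrib m n o))
  (solve 4 (λ a b c d → (a :* b) :* (c :* d) := (a :* c) :* (b :* d)) refl m n (m ℕ.^ o) (n ℕ.^ o))
  where open ℕSolver.+-*-Solver

largest-below : ∀ q r m B → BelowPower q r m (largest q r m B)
largest-below q r@record{} m zero = ℕ.z≤n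
largest-below q r m (suc B)
  with suc B ℕ.^ (↧ₙ r) ℕ.* q ℕ.^ neg (↥ r) ℕ.≤? q ℕ.^ pos (↥ r) ℕ.* m ℕ.^ (↧ₙ r)
... | yes h = h
... | no  _ = largest-below q r m B

largest-above : ∀ q r m B → ¬ BelowPower q r m (suc B) →
                ¬ BelowPower q r m (suc (largest q r m B))
largest-above q r m zero    h = h
largest-above q r m (suc B) h
  with suc B ℕ.^ (↧ₙ r) ℕ.* q ℕ.^ neg (↥ r) ℕ.≤? q ℕ.^ pos (↥ r) ℕ.* m ℕ.^ (↧ₙ r)
... | yes _ = h
... | no  g = largest-above q r m B g

scaledPower-below : ∀ q r m → BelowPower q r m (scaledPower q r m)
scaledPower-below q r m = largest-below q r m (q ℕ.^ pos (↥ r) ℕ.* m)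

scaledPower-above : ∀ q .{{_ : NonZero q}} r m → ¬ BelowPower q r m (suc (scaledPower q r m))
scaledPower-above q r@record{} m = largest-above q r m (Q ℕ.* m) λ h →
  ℕ.<-irrefl refl (begin-strict
    Q ℕ.^ b ℕ.* m ℕ.^ b            ≡⟨ *-^-distrib Q m b ⟨
    (Q ℕ.* m) ℕ.^ b                <⟨ ℕ.^-monoˡ-< b (ℕ.n<1+n (Q ℕ.* m)) ⟩
    suc (Q ℕ.* m) ℕ.^ b            ≡⟨ ℕ.*-identityʳ _ ⟨
    suc (Q ℕ.* m) ℕ.^ b ℕ.* 1      ≤⟨ ℕ.*-monoʳ-≤ (suc (Q ℕ.* m) ℕ.^ b) (ℕ.m^n>0 q (neg (↥ r))) ⟩
    suc (Q ℕ.* m) ℕ.^ b ℕ.* q ℕ.^ neg (↥ r)  ≤⟨ h ⟩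
    Q ℕ.* m ℕ.^ b                  ≤⟨ ℕ.*-monoˡ-≤ (m ℕ.^ b) (m≤m^b Q b) ⟩
    Q ℕ.^ b ℕ.* m ℕ.^ b            ∎)
  where
  open ℕ.≤-Reasoning
  b Q : ℕ
  b = ↧ₙ r
  Q = q ℕ.^ pos (↥ r)
  m≤m^b : ∀ m b .{{_ : NonZero b}} → m ℕ.≤ m ℕ.^ b
  m≤m^b zero    (suc b) = ℕ.z≤n
  m≤m^b (suc m) (suc b) = ℕ.m≤m*n (suc m) (suc m ℕ.^ b) {{ℕ.m^n≢0 (suc m) b}}

bernoulli : ∀ M q n → M ℕ.^ n ℕ.* (M ℕ.+ n ℕ.* q) ℕ.≤ M ℕ.* (M ℕ.+ q) ℕ.^ n
bernoulli M q zero    = ℕ.≤-reflexive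
  (solve 1 (λ a → con 1 :* (a :+ con 0) := a :* con 1) refl M)
  where open ℕSolver.+-*-Solver
bernoulli M q (suc n) = begin
  M ℕ.^ suc n ℕ.* (M ℕ.+ suc n ℕ.* q)
    ≤⟨ ℕ.m≤m+n _ (M ℕ.^ n ℕ.* (n ℕ.* q ℕ.* q)) ⟩
  M ℕ.* M ℕ.^ n ℕ.* (M ℕ.+ suc n ℕ.* q) ℕ.+ M ℕ.^ n ℕ.* (n ℕ.* q ℕ.* q)
    ≡⟨ solve 4 (λ a b c n → a :* b :* (a :+ (c :+ n :* c)) :+ b :* (n :* c :* c)
                  := (a :+ c) :* (b :* (a :+ n :* c))) refl M (M ℕ.^ n) q n ⟩
  (M ℕ.+ q) ℕ.* (M ℕ.^ n ℕ.* (M ℕ.+ n ℕ.* q))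
    ≤⟨ ℕ.*-monoʳ-≤ (M ℕ.+ q) (bernoulli M q n) ⟩
  (M ℕ.+ q) ℕ.* (M ℕ.* (M ℕ.+ q) ℕ.^ n)
    ≡⟨ solve 3 (λ a c d → (a :+ c) :* (a :* d) := a :* ((a :+ c) :* d)) refl M q ((M ℕ.+ q) ℕ.^ n) ⟩
  M ℕ.* (M ℕ.+ q) ℕ.^ suc n ∎
  where open ℕ.≤-Reasoning
        open ℕSolver.+-*-Solver

q*M^M≤[M+q]^M : ∀ q M .{{_ : NonZero M}} → q ℕ.* M ℕ.^ M ℕ.≤ (M ℕ.+ q) ℕ.^ M
q*M^M≤[M+q]^M q M = ℕ.*-cancelˡ-≤ M (begin
  M ℕ.* (q ℕ.* M ℕ.^ M)             ≡⟨ solve 3 (λ a c d → a :* (c :* d) := d :* (a :* c)) refl M q (M ℕ.^ M) ⟩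
  M ℕ.^ M ℕ.* (M ℕ.* q)             ≤⟨ ℕ.*-monoʳ-≤ (M ℕ.^ M) (ℕ.m≤n+m (M ℕ.* q) M) ⟩
  M ℕ.^ M ℕ.* (M ℕ.+ M ℕ.* q)       ≤⟨ bernoulli M q M ⟩
  M ℕ.* (M ℕ.+ q) ℕ.^ M             ∎)
  where open ℕ.≤-Reasoning
        open ℕSolver.+-*-Solver

-- If r ≤ r′ + 1 / M then q ^ r ≤ q ^ r′ * (1 + q / M).
power-continuity : ∀ q .{{_ : NonZero q}} M .{{_ : NonZero M}} k m k′ m′ b b′ p n p′ n′ →
  .{{_ : NonZero b}} → .{{_ : NonZero b′}} →
  k ℕ.^ b ℕ.* q ℕ.^ n ℕ.≤ q ℕ.^ p ℕ.* m ℕ.^ b →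
  q ℕ.^ p′ ℕ.* m′ ℕ.^ b′ ℕ.≤ suc k′ ℕ.^ b′ ℕ.* q ℕ.^ n′ →
  p ℕ.* (b′ ℕ.* M) ℕ.+ n′ ℕ.* (b ℕ.* M) ℕ.≤ p′ ℕ.* (b ℕ.* M) ℕ.+ n ℕ.* (b′ ℕ.* M) ℕ.+ b ℕ.* b′ →
  k ℕ.* m′ ℕ.* M ℕ.≤ suc k′ ℕ.* (M ℕ.+ q) ℕ.* m
power-continuity q M k m k′ m′ b b′ p n p′ n′ e₁ e₂ e₃ =
  ℕ.≮⇒≥ λ lt → ℕ.<⇒≱ (ℕ.^-monoˡ-< L {{L≢0}} lt) powered
  where
  open ℕ.≤-Reasoning
  open ℕSolver.+-*-Solver
  instance
    b′M≢0 : NonZero (b′ ℕ.* M)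
    b′M≢0 = ℕ.m*n≢0 b′ M
  L s w : ℕ
  L = b ℕ.* (b′ ℕ.* M)
  s = suc k′
  w = M ℕ.+ q
  L≢0 : NonZero L
  L≢0 = ℕ.m*n≢0 b (b′ ℕ.* M)

  raise : ∀ x y u v c e f g h →
    x ℕ.^ c ℕ.* y ℕ.^ e ℕ.≤ u ℕ.^ f ℕ.* v ℕ.^ g →
    x ℕ.^ (c ℕ.* h) ℕ.* y ℕ.^ (e ℕ.* h) ℕ.≤ u ℕ.^ (f ℕ.* h) ℕ.* v ℕ.^ (g ℕ.* h)
  raise x y u v c e f g h le = begin
    x ℕ.^ (c ℕ.* h) ℕ.* y ℕ.^ (e ℕ.* h)    ≡⟨ cong₂ ℕ._*_ (ℕ.^-*-assoc x c h) (ℕ.^-*-assoc y e h) ⟨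
    (x ℕ.^ c) ℕ.^ h ℕ.* (y ℕ.^ e) ℕ.^ h    ≡⟨ *-^-distrib (x ℕ.^ c) (y ℕ.^ e) h ⟨
    (x ℕ.^ c ℕ.* y ℕ.^ e) ℕ.^ h            ≤⟨ ℕ.^-monoˡ-≤ h le ⟩
    (u ℕ.^ f ℕ.* v ℕ.^ g) ℕ.^ h            ≡⟨ *-^-distrib (u ℕ.^ f) (v ℕ.^ g) h ⟩
    (u ℕ.^ f) ℕ.^ h ℕ.* (v ℕ.^ g) ℕ.^ h    ≡⟨ cong₂ ℕ._*_ (ℕ.^-*-assoc u f h) (ℕ.^-*-assoc v g h) ⟩
    u ℕ.^ (f ℕ.* h) ℕ.* v ℕ.^ (g ℕ.* h)    ∎

  b′bM≡L : b′ ℕ.* (b ℕ.* M) ≡ L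
  b′bM≡L = solve 3 (λ x y z → y :* (x :* z) := x :* (y :* z)) refl b b′ M

  Mbb′≡L : M ℕ.* (b ℕ.* b′) ≡ L
  Mbb′≡L = solve 3 (λ x y z → z :* (x :* y) := x :* (y :* z)) refl b b′ M

  E₁ : k ℕ.^ L ℕ.* q ℕ.^ (n ℕ.* (b′ ℕ.* M)) ℕ.≤ q ℕ.^ (p ℕ.* (b′ ℕ.* M)) ℕ.* m ℕ.^ L
  E₁ = raise k q q m b n p b (b′ ℕ.* M) e₁

  E₂ : q ℕ.^ (p′ ℕ.* (b ℕ.* M)) ℕ.* m′ ℕ.^ L ℕ.≤ s ℕ.^ L ℕ.* q ℕ.^ (n′ ℕ.* (b ℕ.* M))
  E₂ = subst (λ l → q ℕ.^ (p′ ℕ.* (b ℕ.* M)) ℕ.* m′ ℕ.^ l ℕ.≤ s ℕ.^ l ℕ.* q ℕ.^ (n′ ℕ.* (b ℕ.* M)))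
    b′bM≡L (raise q m′ s q p′ b′ b′ n′ (b ℕ.* M) e₂)

  E₃ : q ℕ.^ (b ℕ.* b′) ℕ.* M ℕ.^ L ℕ.≤ w ℕ.^ L
  E₃ = begin
    q ℕ.^ (b ℕ.* b′) ℕ.* M ℕ.^ L                  ≡⟨ cong (λ l → q ℕ.^ (b ℕ.* b′) ℕ.* M ℕ.^ l) Mbb′≡L ⟨
    q ℕ.^ (b ℕ.* b′) ℕ.* M ℕ.^ (M ℕ.* (b ℕ.* b′)) ≡⟨ cong (q ℕ.^ (b ℕ.* b′) ℕ.*_) (ℕ.^-*-assoc M M (b ℕ.* b′)) ⟨
    q ℕ.^ (b ℕ.* b′) ℕ.* (M ℕ.^ M) ℕ.^ (b ℕ.* b′) ≡⟨ *-^-distrib q (M ℕ.^ M) (b ℕ.* b′) ⟨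
    (q ℕ.* M ℕ.^ M) ℕ.^ (b ℕ.* b′)                ≤⟨ ℕ.^-monoˡ-≤ (b ℕ.* b′) (q*M^M≤[M+q]^M q M) ⟩
    (w ℕ.^ M) ℕ.^ (b ℕ.* b′)                      ≡⟨ ℕ.^-*-assoc w M (b ℕ.* b′) ⟩
    w ℕ.^ (M ℕ.* (b ℕ.* b′))                      ≡⟨ cong (w ℕ.^_) Mbb′≡L ⟩
    w ℕ.^ L                                       ∎

  Qn Qp Qn′ Qp′ Qb : ℕ
  Qn  = q ℕ.^ (n ℕ.* (b′ ℕ.* M))
  Qp  = q ℕ.^ (p ℕ.* (b′ ℕ.* M))
  Qn′ = q ℕ.^ (n′ ℕ.* (b ℕ.* M))
  Qp′ = q ℕ.^ (p′ ℕ.* (b ℕ.* M))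
  Qb  = q ℕ.^ (b ℕ.* b′)

  E₄ : Qp ℕ.* Qn′ ℕ.≤ Qp′ ℕ.* Qn ℕ.* Qb
  E₄ = begin
    Qp ℕ.* Qn′            ≡⟨ ℕ.^-distribˡ-+-* q (p ℕ.* (b′ ℕ.* M)) (n′ ℕ.* (b ℕ.* M)) ⟨
    q ℕ.^ (p ℕ.* (b′ ℕ.* M) ℕ.+ n′ ℕ.* (b ℕ.* M))
                          ≤⟨ ℕ.^-monoʳ-≤ q e₃ ⟩
    q ℕ.^ (p′ ℕ.* (b ℕ.* M) ℕ.+ n ℕ.* (b′ ℕ.* M) ℕ.+ b ℕ.* b′)
                          ≡⟨ ℕ.^-distribˡ-+-* q (p′ ℕ.* (b ℕ.* M) ℕ.+ n ℕ.* (b′ ℕ.* M)) (b ℕ.* b′) ⟩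
    q ℕ.^ (p′ ℕ.* (b ℕ.* M) ℕ.+ n ℕ.* (b′ ℕ.* M)) ℕ.* Qb
                          ≡⟨ cong (ℕ._* Qb) (ℕ.^-distribˡ-+-* q (p′ ℕ.* (b ℕ.* M)) (n ℕ.* (b′ ℕ.* M))) ⟩
    Qp′ ℕ.* Qn ℕ.* Qb     ∎

  Q : ℕ
  Q = Qp′ ℕ.* Qn ℕ.* Qb
  Q≢0 : NonZero Q
  Q≢0 = ℕ.m*n≢0 (Qp′ ℕ.* Qn) Qb
    {{ℕ.m*n≢0 Qp′ Qn {{ℕ.m^n≢0 q (p′ ℕ.* (b ℕ.* M))}} {{ℕ.m^n≢0 q (n ℕ.* (b′ ℕ.* M))}}}}
    {{ℕ.m^n≢0 q (b ℕ.* b′)}}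

  powered : (k ℕ.* m′ ℕ.* M) ℕ.^ L ℕ.≤ (s ℕ.* w ℕ.* m) ℕ.^ L
  powered = ℕ.*-cancelˡ-≤ Q {{Q≢0}} (begin
    Q ℕ.* (k ℕ.* m′ ℕ.* M) ℕ.^ L
      ≡⟨ cong (Q ℕ.*_) (trans (*-^-distrib (k ℕ.* m′) M L) (cong (ℕ._* M ℕ.^ L) (*-^-distrib k m′ L))) ⟩
    Q ℕ.* (k ℕ.^ L ℕ.* m′ ℕ.^ L ℕ.* M ℕ.^ L)
      ≡⟨ solve 6 (λ a b c x y z → (a :* b :* c) :* (x :* y :* z) := (x :* b) :* (a :* y) :* (c :* z)) refl
           Qp′ Qn Qb (k ℕ.^ L) (m′ ℕ.^ L) (M ℕ.^ L) ⟩
    (k ℕ.^ L ℕ.* Qn) ℕ.* (Qp′ ℕ.* m′ ℕ.^ L) ℕ.* (Qb ℕ.* M ℕ.^ L)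
      ≤⟨ ℕ.*-mono-≤ (ℕ.*-mono-≤ E₁ E₂) E₃ ⟩
    (Qp ℕ.* m ℕ.^ L) ℕ.* (s ℕ.^ L ℕ.* Qn′) ℕ.* w ℕ.^ L
      ≡⟨ solve 5 (λ a x y b z → (a :* x) :* (y :* b) :* z := (a :* b) :* (y :* z :* x)) refl
           Qp (m ℕ.^ L) (s ℕ.^ L) Qn′ (w ℕ.^ L) ⟩
    (Qp ℕ.* Qn′) ℕ.* (s ℕ.^ L ℕ.* w ℕ.^ L ℕ.* m ℕ.^ L)
      ≤⟨ ℕ.*-monoˡ-≤ (s ℕ.^ L ℕ.* w ℕ.^ L ℕ.* m ℕ.^ L) E₄ ⟩
    Q ℕ.* (s ℕ.^ L ℕ.* w ℕ.^ L ℕ.* m ℕ.^ L)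
      ≡⟨ cong (Q ℕ.*_) (trans (*-^-distrib (s ℕ.* w) m L) (cong (ℕ._* m ℕ.^ L) (*-^-distrib s w L))) ⟨
    Q ℕ.* (s ℕ.* w ℕ.* m) ℕ.^ L ∎)

i≡pos-neg : ∀ i → i ≡ + pos i ℤ.- + neg i
i≡pos-neg (+ n)    = sym (ℤ.+-identityʳ (+ n))
i≡pos-neg -[1+ n ] = refl

exponent-≤ : ∀ r r′ M → r ℚ.≤ r′ ℚ.+ + 1 / suc M →
  pos (↥ r) ℕ.* (↧ₙ r′ ℕ.* suc M) ℕ.+ neg (↥ r′) ℕ.* (↧ₙ r ℕ.* suc M) ℕ.≤
  pos (↥ r′) ℕ.* (↧ₙ r ℕ.* suc M) ℕ.+ neg (↥ r) ℕ.* (↧ₙ r′ ℕ.* suc M) ℕ.+ ↧ₙ r ℕ.* ↧ₙ r′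
exponent-≤ r@record{} r′@record{} M r≤r′+1/M = ℤ.drop‿+≤+ (subst₂ ℤ._≤_ lhs rhs shifted)
  where
  open ℤSolver.+-*-Solver
  P N P′ N′ B B′ T : ℤ
  P  = + pos (↥ r)
  N  = + neg (↥ r)
  P′ = + pos (↥ r′)
  N′ = + neg (↥ r′)
  B  = ↧ r
  B′ = ↧ r′
  T  = + suc M

  unnormalised : ℚ.toℚᵘ r ℚᵘ.≤ ℚ.toℚᵘ r′ ℚᵘ.+ mkℚᵘ (+ 1) M
  unnormalised = ℚᵘ.≤-respʳ-≃
    (ℚᵘ.≃-trans (ℚ.toℚᵘ-homo-+ r′ (+ 1 / suc M)) (ℚᵘ.+-congʳ (ℚ.toℚᵘ r′) (toℚᵘ-/ (+ 1) M)))
    (ℚ.toℚᵘ-mono-≤ r≤r′+1/M)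

  cleared : ↥ r ℤ.* (B′ ℤ.* T) ℤ.≤ (↥ r′ ℤ.* T ℤ.+ + 1 ℤ.* B′) ℤ.* B
  cleared = ℚᵘ.drop-*≤* unnormalised

  split : (P ℤ.- N) ℤ.* (B′ ℤ.* T) ℤ.≤ ((P′ ℤ.- N′) ℤ.* T ℤ.+ + 1 ℤ.* B′) ℤ.* B
  split = subst₂ (λ i j → i ℤ.* (B′ ℤ.* T) ℤ.≤ (j ℤ.* T ℤ.+ + 1 ℤ.* B′) ℤ.* B)
    (i≡pos-neg (↥ r)) (i≡pos-neg (↥ r′)) cleared

  shifted : P ℤ.* (B′ ℤ.* T) ℤ.+ N′ ℤ.* (B ℤ.* T) ℤ.≤
            P′ ℤ.* (B ℤ.* T) ℤ.+ N ℤ.* (B′ ℤ.* T) ℤ.+ B ℤ.* B′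
  shifted = subst₂ ℤ._≤_
    (solve 6 (λ p n n′ b b′ t → (p :- n) :* (b′ :* t) :+ (n :* (b′ :* t) :+ n′ :* (b :* t))
                := p :* (b′ :* t) :+ n′ :* (b :* t)) refl P N N′ B B′ T)
    (solve 6 (λ p n n′ b b′ t → ((p :- n′) :* t :+ con (+ 1) :* b′) :* b :+ (n :* (b′ :* t) :+ n′ :* (b :* t))
                := p :* (b :* t) :+ n :* (b′ :* t) :+ b :* b′) refl P′ N N′ B B′ T)
    (ℤ.+-monoˡ-≤ (N ℤ.* (B′ ℤ.* T) ℤ.+ N′ ℤ.* (B ℤ.* T)) split)

  cast : ∀ a b c → + a ℤ.* (+ b ℤ.* + c) ≡ + (a ℕ.* (b ℕ.* c))
  cast a b c = sym (trans (ℤ.pos-* a (b ℕ.* c)) (cong (+ a ℤ.*_) (ℤ.pos-* b c)))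

  lhs : P ℤ.* (B′ ℤ.* T) ℤ.+ N′ ℤ.* (B ℤ.* T) ≡
        + (pos (↥ r) ℕ.* (↧ₙ r′ ℕ.* suc M) ℕ.+ neg (↥ r′) ℕ.* (↧ₙ r ℕ.* suc M))
  lhs = trans (cong₂ ℤ._+_ (cast (pos (↥ r)) (↧ₙ r′) (suc M)) (cast (neg (↥ r′)) (↧ₙ r) (suc M)))
    (sym (ℤ.pos-+ (pos (↥ r) ℕ.* (↧ₙ r′ ℕ.* suc M)) _))

  rhs : P′ ℤ.* (B ℤ.* T) ℤ.+ N ℤ.* (B′ ℤ.* T) ℤ.+ B ℤ.* B′ ≡
        + (pos (↥ r′) ℕ.* (↧ₙ r ℕ.* suc M) ℕ.+ neg (↥ r) ℕ.* (↧ₙ r′ ℕ.* suc M) ℕ.+ ↧ₙ r ℕ.* ↧ₙ r′)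
  rhs = trans (cong₂ ℤ._+_
      (trans (cong₂ ℤ._+_ (cast (pos (↥ r′)) (↧ₙ r) (suc M)) (cast (neg (↥ r)) (↧ₙ r′) (suc M)))
             (sym (ℤ.pos-+ (pos (↥ r′) ℕ.* (↧ₙ r ℕ.* suc M)) _)))
      (sym (ℤ.pos-* (↧ₙ r) (↧ₙ r′))))
    (sym (ℤ.pos-+ (pos (↥ r′) ℕ.* (↧ₙ r ℕ.* suc M) ℕ.+ neg (↥ r) ℕ.* (↧ₙ r′ ℕ.* suc M)) _))

scaledPower-≤ : ∀ q .{{_ : NonZero q}} M r r′ m m′ → r ℚ.≤ r′ ℚ.+ + 1 / suc M →
  scaledPower q r m ℕ.* m′ ℕ.* suc M ℕ.≤ suc (scaledPower q r′ m′) ℕ.* (suc M ℕ.+ q) ℕ.* m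
scaledPower-≤ q M r@record{} r′@record{} m m′ r≤ =
  power-continuity q (suc M) (scaledPower q r m) m (scaledPower q r′ m′) m′
    (↧ₙ r) (↧ₙ r′) (pos (↥ r)) (neg (↥ r)) (pos (↥ r′)) (neg (↥ r′))
    (scaledPower-below q r m) (ℕ.≰⇒≥ (scaledPower-above q r′ m′)) (exponent-≤ r r′ M r≤)

-- The n-th approximation to q ^ x is ⌊ (n + 1) q ^ (x n) ⌋ / (n + 1), where
-- x n is the n-th approximation to x.
_^ᴿ_ : (q : ℕ) .{{_ : NonZero q}} → ℝ → ℝ
q ^ᴿ x = mkℝ u u-cauchy
  where
  k : ℕ → ℕ
  k n = scaledPower q (seq x n) (suc n)

  u : ℕ → ℚ
  u n = + k n / suc n

  close : ∀ M {m n} → ℚ.∣ seq x m ℚ.- seq x n ∣ ℚ.< + 1 / suc M →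
          seq x m ℚ.≤ seq x n ℚ.+ + 1 / suc M
  close M {m} {n} h = ℚ.≤-trans (p≤q+∣p-q∣ (seq x m) (seq x n)) (ℚ.+-monoʳ-≤ (seq x n) (ℚ.<⇒≤ h))

  1/-pos : ∀ M → 0ℚ ℚ.< + 1 / suc M
  1/-pos M = ℚ.positive⁻¹ _ {{ℚ.normalize-pos 1 (suc M)}}

  N₀ : ℕ
  N₀ = proj₁ (cauchy x (+ 1 / 1) (1/-pos 0))

  C : ℕ
  C = suc (k N₀) ℕ.* (1 ℕ.+ q)

  k-bounded : ∀ n → N₀ ℕ.≤ n → k n ℕ.≤ C ℕ.* suc n
  k-bounded n N₀≤n = begin
    k n                             ≤⟨ ℕ.m≤m*n (k n) (suc N₀) ⟩
    k n ℕ.* suc N₀                  ≡⟨ ℕ.*-identityʳ _ ⟨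
    k n ℕ.* suc N₀ ℕ.* 1            ≤⟨ scaledPower-≤ q 0 (seq x n) (seq x N₀) (suc n) (suc N₀)
                                         (close 0 (proj₂ (cauchy x (+ 1 / 1) (1/-pos 0)) n N₀ N₀≤n ℕ.≤-refl)) ⟩
    C ℕ.* suc n                     ∎
    where open ℕ.≤-Reasoning

  -- D / (D * suc t) = 1 / suc t, where D bounds (k n + 1) q / (n + 1).
  D : ℕ
  D = suc (suc C ℕ.* q)

  one-sided : ∀ t m n → N₀ ℕ.≤ n → seq x m ℚ.≤ seq x n ℚ.+ + 1 / (D ℕ.* suc t) →
              u m ℚ.≤ u n ℚ.+ (+ 1 / suc n ℚ.+ + 1 / suc t)
  one-sided t m n N₀≤n h = fraction-≤ (k m) m (k n) n t (ℕ.*-cancelˡ-≤ D (begin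
    D ℕ.* (k m ℕ.* (suc n ℕ.* suc t))
      ≡⟨ solve 4 (λ d a b c → d :* (a :* (b :* c)) := a :* b :* (d :* c)) refl D (k m) (suc n) (suc t) ⟩
    k m ℕ.* suc n ℕ.* (D ℕ.* suc t)
      ≤⟨ scaledPower-≤ q (t ℕ.+ suc C ℕ.* q ℕ.* suc t) (seq x m) (seq x n) (suc m) (suc n) h ⟩
    suc (k n) ℕ.* (D ℕ.* suc t ℕ.+ q) ℕ.* suc m
      ≤⟨ ℕ.*-monoˡ-≤ (suc m) inner ⟩
    D ℕ.* (k n ℕ.* suc t ℕ.+ suc t ℕ.+ suc n) ℕ.* suc m
      ≡⟨ ℕ.*-assoc D (k n ℕ.* suc t ℕ.+ suc t ℕ.+ suc n) (suc m) ⟩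
    D ℕ.* ((k n ℕ.* suc t ℕ.+ suc t ℕ.+ suc n) ℕ.* suc m) ∎))
    where
    open ℕ.≤-Reasoning
    open ℕSolver.+-*-Solver
    inner : suc (k n) ℕ.* (D ℕ.* suc t ℕ.+ q) ℕ.≤ D ℕ.* (k n ℕ.* suc t ℕ.+ suc t ℕ.+ suc n)
    inner = begin
      suc (k n) ℕ.* (D ℕ.* suc t ℕ.+ q)
        ≡⟨ ℕ.*-distribˡ-+ (suc (k n)) (D ℕ.* suc t) q ⟩
      suc (k n) ℕ.* (D ℕ.* suc t) ℕ.+ suc (k n) ℕ.* q
        ≤⟨ ℕ.+-monoʳ-≤ (suc (k n) ℕ.* (D ℕ.* suc t))
             (ℕ.*-monoˡ-≤ q (ℕ.+-mono-≤ (ℕ.s≤s (ℕ.z≤n {n})) (k-bounded n N₀≤n))) ⟩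
      suc (k n) ℕ.* (D ℕ.* suc t) ℕ.+ (suc n ℕ.+ C ℕ.* suc n) ℕ.* q
        ≤⟨ ℕ.+-monoʳ-≤ (suc (k n) ℕ.* (D ℕ.* suc t)) (ℕ.m≤n+m _ (suc n)) ⟩
      suc (k n) ℕ.* (D ℕ.* suc t) ℕ.+ (suc n ℕ.+ (suc n ℕ.+ C ℕ.* suc n) ℕ.* q)
        ≡⟨ solve 5 (λ κ τ ν c q →
             (con 1 :+ κ) :* ((con 1 :+ (con 1 :+ c) :* q) :* τ) :+ (ν :+ (ν :+ c :* ν) :* q)
             := (con 1 :+ (con 1 :+ c) :* q) :* (κ :* τ :+ τ :+ ν)) refl (k n) (suc t) (suc n) C q ⟩
      D ℕ.* (k n ℕ.* suc t ℕ.+ suc t ℕ.+ suc n) ∎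

  u-cauchy : ∀ ε → 0ℚ ℚ.< ε →
             ∃[ N ] ∀ m n → N ℕ.≤ m → N ℕ.≤ n → ℚ.∣ u m ℚ.- u n ∣ ℚ.< ε
  u-cauchy ε 0<ε = N , λ m n N≤m N≤n → ∣p-q∣<ε (half m n N≤m N≤n) (half n m N≤n N≤m)
    where
    t M N₁ N : ℕ
    t  = ↧ₙ (½ ℚ.* ε)
    M  = t ℕ.+ suc C ℕ.* q ℕ.* suc t
    N₁ = proj₁ (cauchy x (+ 1 / suc M) (1/-pos M))
    N  = N₀ ℕ.⊔ N₁ ℕ.⊔ t
    small : ∀ n → t ℕ.≤ n → + 1 / suc n ℚ.< ½ ℚ.* ε
    small = 1/-small (half-pos 0<ε)
    half : ∀ m n → N ℕ.≤ m → N ℕ.≤ n → u m ℚ.< u n ℚ.+ ε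
    half m n N≤m N≤n = begin-strict
      u m
        ≤⟨ one-sided t m n (ℕ.m⊔n≤o⇒m≤o N₀ N₁ (ℕ.m⊔n≤o⇒m≤o (N₀ ℕ.⊔ N₁) t N≤n))
             (close M (proj₂ (cauchy x (+ 1 / suc M) (1/-pos M)) m n
               (ℕ.m⊔n≤o⇒n≤o N₀ N₁ (ℕ.m⊔n≤o⇒m≤o (N₀ ℕ.⊔ N₁) t N≤m))
               (ℕ.m⊔n≤o⇒n≤o N₀ N₁ (ℕ.m⊔n≤o⇒m≤o (N₀ ℕ.⊔ N₁) t N≤n)))) ⟩
      u n ℚ.+ (+ 1 / suc n ℚ.+ + 1 / suc t)
        <⟨ ℚ.+-monoʳ-< (u n) (ℚ.+-mono-< (small n (ℕ.m⊔n≤o⇒n≤o (N₀ ℕ.⊔ N₁) t N≤n)) (small t ℕ.≤-refl)) ⟩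
      u n ℚ.+ (½ ℚ.* ε ℚ.+ ½ ℚ.* ε)
        ≡⟨ cong (u n ℚ.+_) (half+half ε) ⟩
      u n ℚ.+ ε ∎
      where open ℚ.≤-Reasoning

------------------------------------------------------------------------
-- Lebesgue null sets

sum< : ℕ → (ℕ → ℚ) → ℚ
sum< zero    f = 0ℚ
sum< (suc n) f = sum< n f ℚ.+ f n

-- Outer measure zero.  Bounding every partial sum of the non-negative
-- lengths by ε bounds the total length; rational endpoints lose no
-- generality, since intervals may be enlarged slightly.
Null : Pred ℝ 0ℓ → Set
Null A = ∀ ε → 0ℚ ℚ.< ε →
  Σ[ a ∈ (ℕ → ℚ) ] Σ[ b ∈ (ℕ → ℚ) ]
      (∀ n → a n ℚ.≤ b n)
    × (∀ n → sum< n (λ i → b i ℚ.- a i) ℚ.≤ ε)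
    × (∀ α → A α → ∃[ n ] ι (a n) <ᴿ α × α <ᴿ ι (b n))

-- Every exception to A lies in a null set N; classically N may be taken to
-- be the set of exceptions itself.  Constructively, ¬ A α need not supply
-- the data that selects an interval around α, while N can carry it.
AlmostAll : Pred ℝ 0ℓ → Set₁
AlmostAll A = ∃[ N ] Null N × (∀ α → ¬ N α → A α)

------------------------------------------------------------------------
-- Simultaneous approximation

-- Coefficients, constant term first.
record Polynomial (d : ℕ) : Set where
  field
    coefficients : Vec ℤ (suc d)
    leading≢0    : last coefficients ≢ + 0

open Polynomial public

horner : ∀ {n} → Vec ℤ n → ℝ → ℝ
horner []       x = ι 0ℚ
horner (a ∷ as) x = ι (a / 1) +ᴿ x *ᴿ horner as x

eval : ∀ {d} → Polynomial d → ℝ → ℝ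
eval P = horner (coefficients P)

-- No finite list exhausts S.
Infinite : {A : Set} → Pred A 0ℓ → Set
Infinite {A} S = (xs : List A) → ∃[ x ] S x × x ∉ xs

Triple : Set
Triple = ℤ × ℤ × ℕ

-- 1 / q ^ τ is the real power q ^ᴿ (-ᴿ τ).
Approximates : ℝ → (ℝ → ℝ) → ℝ → Pred Triple 0ℓ
Approximates τ f x (p , r , zero)      = ⊥
Approximates τ f x (p , r , q@(suc _)) =
    (∣ x   -ᴿ ι (p / q) ∣ᴿ <ᴿ q ^ᴿ (-ᴿ τ))
  × (∣ f x -ᴿ ι (r / q) ∣ᴿ <ᴿ q ^ᴿ (-ᴿ τ))

W : ℝ → (ℝ → ℝ) → Pred ℝ 0ℓ
W τ f x = Infinite (Approximates τ f x)

shift : ∀ {d} → Polynomial d → ℝ → (ℝ → ℝ)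
shift P α x = eval P x +ᴿ α

{-# OPTIONS --safe #-}
module Submission where

-- If (p , r , q) approximates x and α to within q ^ -τ, then P(p / q) is close
-- to P(x), so α lies within a constant times q ^ -τ of r / q - P(p / q), a
-- fraction with denominator q ^ d.  In a bounded range there are about q ^ d
-- such fractions, and Σ q ^ d q ^ -τ converges for τ > d + 1; by the
-- Borel–Cantelli lemma the α that are hit infinitely often form a null set.

-- The constant in front of q ^ -τ and the range of the fractions both depend on bounds for x and α,
-- whereas one cover has to serve the whole line. The gap between τ and d + 1 pays for this: the
-- denominators are grouped into blocks, and each block is covered with a radius and a range of
-- centres enlarged by factors that grow with the block. So there is no reduction to bounded sets
-- and no countable union of null sets. Blocks that end at powers of 2 also turn the convergence of
-- Σ q ^ (d - τ) into that of a geometric series, and the real power q ^ -τ enters only through an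
-- upper bound 2 ^ -E, which is checked on rational exponents by comparing natural numbers. What is
-- used of τ is a rational gap: from some index on, its approximations are at least d + 1 + 1 / (M +
-- 1).

open import Defs
open import Algebra.Bundles using (CommutativeRing)
open import Data.Integer using (+_)
open import Data.Integer as ℤ using (ℤ; -[1+_])
import Data.Integer.Properties as ℤ
import Data.Integer.Solver as ℤSolver
open import Data.List using (List; []; _∷_; _++_; cartesianProduct; length; map; upTo)
open import Data.List.Membership.Propositional using (_∈_; _∉_)
open import Data.List.Membership.Propositional.Properties
  using (∈-++⁺ʳ; ∈-++⁺ˡ; ∈-cartesianProduct⁺; ∈-map⁺; ∈-upTo⁺)
open import Data.List.Properties using (length-++; length-map; length-upTo)
open import Data.List.Relation.Unary.Any using (here; there)
open import Data.Nat using (ℕ; _+_; _≤_)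
open import Data.Nat as ℕ using (zero; suc)
import Data.Nat.Properties as ℕ
import Data.Nat.Solver as ℕSolver
open import Data.Product using (∃-syntax; _×_; _,_; proj₁; proj₂)
open import Data.Rational using (_/_)
open import Data.Rational as ℚ using (ℚ; 0ℚ; 1ℚ; ↥_; ↧_; ↧ₙ_)
import Data.Rational.Properties as ℚ
import Data.Rational.Solver as ℚSolver
open import Data.Rational.Unnormalised as ℚᵘ using (mkℚᵘ)
import Data.Rational.Unnormalised.Properties as ℚᵘ
open import Data.Vec using (Vec; []; _∷_)
open import Function using (_∘_)
open import Level using (0ℓ)
open import Relation.Binary.PropositionalEquality
open import Relation.Nullary using (contradiction; no; yes)
open import Relation.Unary using (Empty; Pred)
open import Algebra.Properties.CommutativeSemiring.Exp
  (CommutativeRing.commutativeSemiring ℚ.+-*-commutativeRing)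
  using (_^_; ^-distrib-*; ^-homo-*)

-- Integers, reciprocals and powers in ℚ

-- Opaque, since _/_ otherwise unfolds to computations with gcds.
abstract
  int : ℤ → ℚ
  int i = i / 1

  recip : ℕ → ℚ
  recip n = + 1 / suc n

nat : ℕ → ℚ
nat n = int (+ n)

abstract
  toℚᵘ-int : ∀ i → ℚ.toℚᵘ (int i) ℚᵘ.≃ mkℚᵘ i 0
  toℚᵘ-int i = toℚᵘ-/ i 0

  toℚᵘ-recip : ∀ n → ℚ.toℚᵘ (recip n) ℚᵘ.≃ mkℚᵘ (+ 1) n
  toℚᵘ-recip n = toℚᵘ-/ (+ 1) n

  int-+ : ∀ i j → int (i ℤ.+ j) ≡ int i ℚ.+ int j
  int-+ i j = ℚ.toℚᵘ-injective
    (ℚᵘ.≃-trans (toℚᵘ-int (i ℤ.+ j))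
    (ℚᵘ.≃-trans (ℚᵘ.*≡* (solve 2 (λ i j → (i :+ j) :* con (+ 1) := (i :* con (+ 1) :+ j :* con (+ 1)) :* con (+ 1)) refl i j))
    (ℚᵘ.≃-sym (ℚᵘ.≃-trans (ℚ.toℚᵘ-homo-+ (int i) (int j)) (ℚᵘ.+-cong (toℚᵘ-int i) (toℚᵘ-int j))))))
    where open ℤSolver.+-*-Solver

  int-* : ∀ i j → int (i ℤ.* j) ≡ int i ℚ.* int j
  int-* i j = ℚ.toℚᵘ-injective
    (ℚᵘ.≃-trans (toℚᵘ-int (i ℤ.* j))
    (ℚᵘ.≃-sym (ℚᵘ.≃-trans (ℚ.toℚᵘ-homo-* (int i) (int j)) (ℚᵘ.*-cong (toℚᵘ-int i) (toℚᵘ-int j)))))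

  int-neg : ∀ i → int (ℤ.- i) ≡ ℚ.- int i
  int-neg i = ℚ.toℚᵘ-injective
    (ℚᵘ.≃-trans (toℚᵘ-int (ℤ.- i))
    (ℚᵘ.≃-sym (ℚᵘ.≃-trans (ℚ.toℚᵘ-homo‿- (int i)) (ℚᵘ.-‿cong (toℚᵘ-int i)))))

  ∣int∣ : ∀ i → ℚ.∣ int i ∣ ≡ nat ℤ.∣ i ∣
  ∣int∣ i = ℚ.toℚᵘ-injective
    (ℚᵘ.≃-trans (ℚ.toℚᵘ-homo-∣-∣ (int i))
    (ℚᵘ.≃-trans (ℚᵘ.∣-∣-cong (toℚᵘ-int i)) (ℚᵘ.≃-sym (toℚᵘ-int (+ ℤ.∣ i ∣)))))

  nat-* : ∀ m n → nat (m ℕ.* n) ≡ nat m ℚ.* nat n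
  nat-* m n = trans (cong int (ℤ.pos-* m n)) (int-* (+ m) (+ n))

  nat-mono-≤ : ∀ {m n} → m ≤ n → nat m ℚ.≤ nat n
  nat-mono-≤ {m} {n} m≤n = ℚ.toℚᵘ-cancel-≤
    (ℚᵘ.≤-respˡ-≃ (ℚᵘ.≃-sym (toℚᵘ-int (+ m))) (ℚᵘ.≤-respʳ-≃ (ℚᵘ.≃-sym (toℚᵘ-int (+ n)))
      (ℚᵘ.*≤* (ℤ.*-monoʳ-≤-nonNeg (+ 1) (ℤ.+≤+ m≤n)))))

  nat-cancel-≤ : ∀ {m n} → nat m ℚ.≤ nat n → m ≤ n
  nat-cancel-≤ {m} {n} h = ℤ.drop‿+≤+ (ℤ.*-cancelʳ-≤-pos (+ m) (+ n) (+ 1)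
    (ℚᵘ.drop-*≤* (ℚᵘ.≤-respˡ-≃ (toℚᵘ-int (+ m)) (ℚᵘ.≤-respʳ-≃ (toℚᵘ-int (+ n)) (ℚ.toℚᵘ-mono-≤ h)))))

  0≤nat : ∀ n → 0ℚ ℚ.≤ nat n
  0≤nat n = nat-mono-≤ {0} {n} ℕ.z≤n

  0≤recip : ∀ n → 0ℚ ℚ.≤ recip n
  0≤recip n = ℚ.<⇒≤ (ℚ.positive⁻¹ _ {{ℚ.normalize-pos 1 (suc n)}})

  /≡int*recip : ∀ i n → i / suc n ≡ int i ℚ.* recip n
  /≡int*recip i n = ℚ.toℚᵘ-injective
    (ℚᵘ.≃-trans (toℚᵘ-/ i n)
    (ℚᵘ.≃-trans (ℚᵘ.*≡* (solve 2 (λ i n → i :* (con (+ 1) :* n) := (i :* con (+ 1)) :* n) refl i (+ suc n)))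
    (ℚᵘ.≃-sym (ℚᵘ.≃-trans (ℚ.toℚᵘ-homo-* (int i) (recip n)) (ℚᵘ.*-cong (toℚᵘ-int i) (toℚᵘ-/ (+ 1) n))))))
    where open ℤSolver.+-*-Solver

  nat*recip : ∀ n → nat (suc n) ℚ.* recip n ≡ 1ℚ
  nat*recip n = trans (sym (/≡int*recip (+ suc n) n)) (ℚ.toℚᵘ-injective
    (ℚᵘ.≃-trans (toℚᵘ-/ (+ suc n) n) (ℚᵘ.*≡* (ℤ.*-comm (+ suc n) (+ 1)))))

  int-def : ∀ i → i / 1 ≡ int i
  int-def i = refl

  recip<ε : ∀ {ε} → 0ℚ ℚ.< ε → recip (↧ₙ ε) ℚ.< ε
  recip<ε {ε} 0<ε = 1/-small 0<ε (↧ₙ ε) ℕ.≤-refl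

  1+1≡nat2 : 1ℚ ℚ.+ 1ℚ ≡ nat 2
  1+1≡nat2 = refl

  nat0≡0 : nat 0 ≡ 0ℚ
  nat0≡0 = refl

  nat1≡1 : nat 1 ≡ 1ℚ
  nat1≡1 = refl

  ≤-nat : ∀ p → ∃[ n ] p ℚ.≤ nat n
  ≤-nat p@record{} = ℤ.∣ ↥ p ∣ , ℚ.≤-trans (p≤∣p∣ p) (ℚ.toℚᵘ-cancel-≤
    (ℚᵘ.≤-respʳ-≃ (ℚᵘ.≃-sym (toℚᵘ-int (+ ℤ.∣ ↥ p ∣)))
      (ℚᵘ.*≤* (ℤ.*-monoˡ-≤-nonNeg (+ ℤ.∣ ↥ p ∣) (ℤ.+≤+ (ℕ.s≤s (ℕ.z≤n {ℚ.ℚ.denominator-1 p})))))))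

nat-^ : ∀ m n → nat (m ℕ.^ n) ≡ nat m ^ n
nat-^ m zero    = nat1≡1
nat-^ m (suc n) = trans (nat-* m (m ℕ.^ n)) (cong (nat m ℚ.*_) (nat-^ m n))

1^n≡1 : ∀ n → 1ℚ ^ n ≡ 1ℚ
1^n≡1 zero    = refl
1^n≡1 (suc n) = trans (ℚ.*-identityˡ _) (1^n≡1 n)

nat^*recip^ : ∀ q n → nat (suc q ℕ.^ n) ℚ.* recip q ^ n ≡ 1ℚ
nat^*recip^ q n = begin
  nat (suc q ℕ.^ n) ℚ.* recip q ^ n  ≡⟨ cong (ℚ._* recip q ^ n) (nat-^ (suc q) n) ⟩
  nat (suc q) ^ n ℚ.* recip q ^ n    ≡⟨ ^-distrib-* (nat (suc q)) (recip q) n ⟨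
  (nat (suc q) ℚ.* recip q) ^ n      ≡⟨ cong (_^ n) (nat*recip q) ⟩
  1ℚ ^ n                             ≡⟨ 1^n≡1 n ⟩
  1ℚ                                 ∎
  where open ≡-Reasoning

*-monoˡ-≤ : ∀ {p q} r → 0ℚ ℚ.≤ r → p ℚ.≤ q → r ℚ.* p ℚ.≤ r ℚ.* q
*-monoˡ-≤ r 0≤r = ℚ.*-monoˡ-≤-nonNeg r {{ℚ.nonNegative 0≤r}}

*-monoʳ-≤ : ∀ {p q} r → 0ℚ ℚ.≤ r → p ℚ.≤ q → p ℚ.* r ℚ.≤ q ℚ.* r
*-monoʳ-≤ r 0≤r = ℚ.*-monoʳ-≤-nonNeg r {{ℚ.nonNegative 0≤r}}

*-mono-≤ : ∀ {p q r s} → 0ℚ ℚ.≤ q → 0ℚ ℚ.≤ r → p ℚ.≤ q → r ℚ.≤ s → p ℚ.* r ℚ.≤ q ℚ.* s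
*-mono-≤ {q = q} {r} 0≤q 0≤r p≤q r≤s = ℚ.≤-trans (*-monoʳ-≤ r 0≤r p≤q) (*-monoˡ-≤ q 0≤q r≤s)

0≤p*q : ∀ {p q} → 0ℚ ℚ.≤ p → 0ℚ ℚ.≤ q → 0ℚ ℚ.≤ p ℚ.* q
0≤p*q {p} 0≤p 0≤q = ℚ.≤-trans (ℚ.≤-reflexive (sym (ℚ.*-zeroʳ p))) (*-monoˡ-≤ p 0≤p 0≤q)

0≤p+q : ∀ {p q} → 0ℚ ℚ.≤ p → 0ℚ ℚ.≤ q → 0ℚ ℚ.≤ p ℚ.+ q
0≤p+q 0≤p 0≤q = ℚ.≤-trans (ℚ.≤-reflexive (sym (ℚ.+-identityʳ 0ℚ))) (ℚ.+-mono-≤ 0≤p 0≤q)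

0≤p^n : ∀ {p} n → 0ℚ ℚ.≤ p → 0ℚ ℚ.≤ p ^ n
0≤p^n zero    0≤p = ℚ.<⇒≤ (ℚ.positive⁻¹ 1ℚ)
0≤p^n (suc n) 0≤p = 0≤p*q 0≤p (0≤p^n n 0≤p)

p+p≡nat2*p : ∀ p → p ℚ.+ p ≡ nat 2 ℚ.* p
p+p≡nat2*p p = begin
  p ℚ.+ p                         ≡⟨ cong₂ ℚ._+_ (ℚ.*-identityˡ p) (ℚ.*-identityˡ p) ⟨
  1ℚ ℚ.* p ℚ.+ 1ℚ ℚ.* p           ≡⟨ ℚ.*-distribʳ-+ p 1ℚ 1ℚ ⟨
  (1ℚ ℚ.+ 1ℚ) ℚ.* p               ≡⟨ cong (ℚ._* p) 1+1≡nat2 ⟩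
  nat 2 ℚ.* p                     ∎
  where open ≡-Reasoning

1+n≤2^n : ∀ n → suc n ≤ 2 ℕ.^ n
1+n≤2^n zero    = ℕ.≤-refl
1+n≤2^n (suc n) = begin
  suc (suc n)            ≤⟨ ℕ.+-mono-≤ (ℕ.m^n>0 2 n) (1+n≤2^n n) ⟩
  2 ℕ.^ n + 2 ℕ.^ n      ≡⟨ cong (_+_ (2 ℕ.^ n)) (ℕ.+-identityʳ _) ⟨
  2 ℕ.^ suc n            ∎
  where open ℕ.≤-Reasoning

half : ℚ
half = recip 1

0≤half^ : ∀ n → 0ℚ ℚ.≤ half ^ n
0≤half^ n = 0≤p^n n (0≤recip 1)

2^n*half^n : ∀ n → nat (2 ℕ.^ n) ℚ.* half ^ n ≡ 1ℚ
2^n*half^n = nat^*recip^ 1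

n*half^n≤1 : ∀ n → nat (suc n) ℚ.* half ^ n ℚ.≤ 1ℚ
n*half^n≤1 n = ℚ.≤-trans (*-monoʳ-≤ (half ^ n) (0≤half^ n) (nat-mono-≤ (1+n≤2^n n)))
  (ℚ.≤-reflexive (2^n*half^n n))

half^n≤1 : ∀ n → half ^ n ℚ.≤ 1ℚ
half^n≤1 n = begin
  half ^ n                        ≡⟨ ℚ.*-identityˡ _ ⟨
  1ℚ ℚ.* half ^ n                 ≡⟨ cong (ℚ._* half ^ n) nat1≡1 ⟨
  nat 1 ℚ.* half ^ n              ≤⟨ *-monoʳ-≤ (half ^ n) (0≤half^ n) (nat-mono-≤ (ℕ.s≤s ℕ.z≤n)) ⟩
  nat (suc n) ℚ.* half ^ n        ≤⟨ n*half^n≤1 n ⟩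
  1ℚ                              ∎
  where open ℚ.≤-Reasoning

half^n≤recip : ∀ n → half ^ n ℚ.≤ recip n
half^n≤recip n = begin
  half ^ n                                      ≡⟨ ℚ.*-identityˡ _ ⟨
  1ℚ ℚ.* half ^ n                               ≡⟨ cong (ℚ._* half ^ n) (nat*recip n) ⟨
  nat (suc n) ℚ.* recip n ℚ.* half ^ n          ≡⟨ solve 3 (λ a b c → a :* b :* c := b :* (a :* c)) refl (nat (suc n)) (recip n) (half ^ n) ⟩
  recip n ℚ.* (nat (suc n) ℚ.* half ^ n)        ≤⟨ *-monoˡ-≤ (recip n) (0≤recip n) (n*half^n≤1 n) ⟩
  recip n ℚ.* 1ℚ                                ≡⟨ ℚ.*-identityʳ _ ⟩
  recip n                                       ∎
  where open ℚ.≤-Reasoning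
        open ℚSolver.+-*-Solver

-- The exponent is split: `half ^ K` absorbs `c`, which is at most `K`, and `half ^ (↧ₙ ε)` is at
-- most 1 / (↧ₙ ε + 1), which is below `ε`.
half^-vanishes : ∀ c ε → 0ℚ ℚ.< ε → ∃[ n ] c ℚ.* half ^ n ℚ.≤ ε
half^-vanishes c ε 0<ε with K , c≤K ← ≤-nat c = K + ↧ₙ ε , (begin
  c ℚ.* half ^ (K + ↧ₙ ε)                  ≤⟨ *-monoʳ-≤ _ (0≤half^ (K + ↧ₙ ε)) (ℚ.≤-trans c≤K (nat-mono-≤ (ℕ.n≤1+n K))) ⟩
  nat (suc K) ℚ.* half ^ (K + ↧ₙ ε)        ≡⟨ cong (nat (suc K) ℚ.*_) (^-homo-* half K (↧ₙ ε)) ⟩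
  nat (suc K) ℚ.* (half ^ K ℚ.* half ^ (↧ₙ ε))  ≡⟨ ℚ.*-assoc (nat (suc K)) _ _ ⟨
  nat (suc K) ℚ.* half ^ K ℚ.* half ^ (↧ₙ ε)    ≤⟨ *-monoʳ-≤ _ (0≤half^ (↧ₙ ε)) (n*half^n≤1 K) ⟩
  1ℚ ℚ.* half ^ (↧ₙ ε)                     ≡⟨ ℚ.*-identityˡ _ ⟩
  half ^ (↧ₙ ε)                            ≤⟨ half^n≤recip (↧ₙ ε) ⟩
  recip (↧ₙ ε)                             ≤⟨ ℚ.<⇒≤ (recip<ε 0<ε) ⟩
  ε                                        ∎)
  where open ℚ.≤-Reasoning

-- Interval covers and null sets

record Interval : Set where
  constructor interval
  field
    lower upper : ℚ
    lower≤upper : lower ℚ.≤ upper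

open Interval

width : Interval → ℚ
width I = upper I ℚ.- lower I

0≤width : ∀ I → 0ℚ ℚ.≤ width I
0≤width I = ℚ.≤-trans (ℚ.≤-reflexive (sym (ℚ.+-inverseʳ (lower I))))
  (ℚ.+-monoˡ-≤ (ℚ.- lower I) (lower≤upper I))

totalWidth : List Interval → ℚ
totalWidth []       = 0ℚ
totalWidth (I ∷ Is) = width I ℚ.+ totalWidth Is

0≤totalWidth : ∀ Is → 0ℚ ℚ.≤ totalWidth Is
0≤totalWidth []       = ℚ.≤-refl
0≤totalWidth (I ∷ Is) = 0≤p+q (0≤width I) (0≤totalWidth Is)

infix 4 _∋ᴿ_
_∋ᴿ_ : Interval → ℝ → Set
I ∋ᴿ α = ι (lower I) <ᴿ α × α <ᴿ ι (upper I)

-- A degenerate interval separates consecutive blocks, so that empty blocks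
-- need no special treatment.
concatenate : (ℕ → List Interval) → List Interval → ℕ → Interval
concatenate L []       zero    = interval 0ℚ 0ℚ ℚ.≤-refl
concatenate L []       (suc n) = concatenate (L ∘ suc) (L 0) n
concatenate L (I ∷ Is) zero    = I
concatenate L (I ∷ Is) (suc n) = concatenate L Is n

concatenate-head : ∀ L Is {I} → I ∈ Is → ∃[ n ] concatenate L Is n ≡ I
concatenate-head L (J ∷ Is) (here refl)  = 0 , refl
concatenate-head L (J ∷ Is) (there I∈Is) with n , eq ← concatenate-head L Is I∈Is = suc n , eq

concatenate-block : ∀ L Is j {I} → I ∈ L j → ∃[ n ] concatenate L Is n ≡ I
concatenate-block L []       zero    I∈Lj with n , eq ← concatenate-head (L ∘ suc) (L 0) I∈Lj = suc n , eq
concatenate-block L []       (suc j) I∈Lj with n , eq ← concatenate-block (L ∘ suc) (L 0) j I∈Lj = suc n , eq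
concatenate-block L (_ ∷ Is) j       I∈Lj with n , eq ← concatenate-block L Is j I∈Lj = suc n , eq

sum<-suc : ∀ n f → sum< (suc n) f ≡ f 0 ℚ.+ sum< n (f ∘ suc)
sum<-suc zero    f = ℚ.+-comm 0ℚ (f 0)
sum<-suc (suc n) f = trans (cong (ℚ._+ f (suc n)) (sum<-suc n f)) (ℚ.+-assoc (f 0) _ _)

-- `t j` stands for the tail of the series of widths from block `j` on. The telescoping inequality
-- replaces an infinite sum and carries the induction from one block to the next, for partial sums
-- that may stop inside a block.
concatenate-width : ∀ L (t : ℕ → ℚ) → (∀ j → 0ℚ ℚ.≤ t j) →
  (∀ j → totalWidth (L j) ℚ.+ t (suc j) ℚ.≤ t j) →
  ∀ Is n → sum< n (width ∘ concatenate L Is) ℚ.≤ totalWidth Is ℚ.+ t 0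
concatenate-width L t 0≤t step Is zero = 0≤p+q (0≤totalWidth Is) (0≤t 0)
concatenate-width L t 0≤t step [] (suc n) = begin
  sum< (suc n) (width ∘ concatenate L [])                 ≡⟨ sum<-suc n _ ⟩
  0ℚ ℚ.+ sum< n (width ∘ concatenate (L ∘ suc) (L 0))     ≤⟨ ℚ.+-monoʳ-≤ 0ℚ (concatenate-width (L ∘ suc) (t ∘ suc) (0≤t ∘ suc) (step ∘ suc) (L 0) n) ⟩
  0ℚ ℚ.+ (totalWidth (L 0) ℚ.+ t 1)                       ≤⟨ ℚ.+-monoʳ-≤ 0ℚ (step 0) ⟩
  0ℚ ℚ.+ t 0                                              ∎
  where open ℚ.≤-Reasoning
concatenate-width L t 0≤t step (I ∷ Is) (suc n) = begin
  sum< (suc n) (width ∘ concatenate L (I ∷ Is))           ≡⟨ sum<-suc n _ ⟩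
  width I ℚ.+ sum< n (width ∘ concatenate L Is)           ≤⟨ ℚ.+-monoʳ-≤ (width I) (concatenate-width L t 0≤t step Is n) ⟩
  width I ℚ.+ (totalWidth Is ℚ.+ t 0)                     ≡⟨ ℚ.+-assoc (width I) _ _ ⟨
  totalWidth (I ∷ Is) ℚ.+ t 0                             ∎
  where open ℚ.≤-Reasoning

-- For given `ε` the blocks before some `j₀` are dropped: the widths that remain sum to at most 2c ·
-- 2 ^ -j₀, hence to at most `ε`. What remains still covers `A`, since each of its points lies in
-- blocks of arbitrarily large index.
borel-cantelli : ∀ (L : ℕ → List Interval) c → 0ℚ ℚ.≤ c →
  (∀ j → totalWidth (L j) ℚ.≤ c ℚ.* half ^ j) → (A : Pred ℝ 0ℓ) →
  (∀ α → A α → ∀ j₀ → ∃[ j ] j₀ ≤ j × ∃[ I ] I ∈ L j × I ∋ᴿ α) → Null A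
borel-cantelli L c 0≤c width≤ A cover ε 0<ε =
  (lower ∘ K) , (upper ∘ K) , (lower≤upper ∘ K) , width-≤-ε ,
  λ α Aα → find α (cover α Aα j₀)
  where
  open ℚ.≤-Reasoning
  open ℚSolver.+-*-Solver

  j₀ : ℕ
  j₀ = proj₁ (half^-vanishes (c ℚ.+ c) ε 0<ε)

  L′ : ℕ → List Interval
  L′ j = L (j₀ + j)

  K : ℕ → Interval
  K = concatenate L′ []

  t : ℕ → ℚ
  t j = (c ℚ.+ c) ℚ.* half ^ (j₀ + j)

  0≤t : ∀ j → 0ℚ ℚ.≤ t j
  0≤t j = 0≤p*q (0≤p+q 0≤c 0≤c) (0≤half^ (j₀ + j))

  double-half : ∀ x → (c ℚ.+ c) ℚ.* (half ℚ.* x) ≡ c ℚ.* x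
  double-half x = begin-equality
    (c ℚ.+ c) ℚ.* (half ℚ.* x)             ≡⟨ cong (ℚ._* (half ℚ.* x)) (p+p≡nat2*p c) ⟩
    nat 2 ℚ.* c ℚ.* (half ℚ.* x)           ≡⟨ solve 4 (λ n c h x → n :* c :* (h :* x) := n :* h :* (c :* x)) refl (nat 2) c half x ⟩
    nat 2 ℚ.* half ℚ.* (c ℚ.* x)           ≡⟨ cong (ℚ._* (c ℚ.* x)) (nat*recip 1) ⟩
    1ℚ ℚ.* (c ℚ.* x)                       ≡⟨ ℚ.*-identityˡ _ ⟩
    c ℚ.* x                                ∎

  step : ∀ j → totalWidth (L′ j) ℚ.+ t (suc j) ℚ.≤ t j
  step j = begin
    totalWidth (L′ j) ℚ.+ t (suc j)        ≡⟨ cong (λ k → totalWidth (L′ j) ℚ.+ (c ℚ.+ c) ℚ.* half ^ k) (ℕ.+-suc j₀ j) ⟩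
    totalWidth (L′ j) ℚ.+ (c ℚ.+ c) ℚ.* (half ℚ.* h)  ≡⟨ cong (totalWidth (L′ j) ℚ.+_) (double-half h) ⟩
    totalWidth (L′ j) ℚ.+ c ℚ.* h          ≤⟨ ℚ.+-monoˡ-≤ (c ℚ.* h) (width≤ (j₀ + j)) ⟩
    c ℚ.* h ℚ.+ c ℚ.* h                    ≡⟨ ℚ.*-distribʳ-+ h c c ⟨
    t j                                    ∎
    where
    h : ℚ
    h = half ^ (j₀ + j)

  width-≤-ε : ∀ n → sum< n (width ∘ K) ℚ.≤ ε
  width-≤-ε n = begin
    sum< n (width ∘ K)                     ≤⟨ concatenate-width L′ t 0≤t step [] n ⟩
    0ℚ ℚ.+ t 0                             ≡⟨ ℚ.+-identityˡ (t 0) ⟩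
    (c ℚ.+ c) ℚ.* half ^ (j₀ + 0)          ≡⟨ cong (λ j → (c ℚ.+ c) ℚ.* half ^ j) (ℕ.+-identityʳ j₀) ⟩
    (c ℚ.+ c) ℚ.* half ^ j₀                ≤⟨ proj₂ (half^-vanishes (c ℚ.+ c) ε 0<ε) ⟩
    ε                                      ∎

  find : ∀ α → ∃[ j ] j₀ ≤ j × ∃[ I ] I ∈ L j × I ∋ᴿ α → ∃[ n ] K n ∋ᴿ α
  find α (j , j₀≤j , I , I∈Lj , I∋α) =
    let n , eq = concatenate-block L′ [] (j ℕ.∸ j₀) (subst (λ k → I ∈ L k) (sym (ℕ.m+[n∸m]≡n j₀≤j)) I∈Lj)
    in n , subst (_∋ᴿ α) (sym eq) I∋α

-- Integer polynomials on ℚ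

hornerℚ : ∀ {n} → Vec ℤ n → ℚ → ℚ
hornerℚ []       y = 0ℚ
hornerℚ (a ∷ as) y = int a ℚ.+ y ℚ.* hornerℚ as y

-- The real operations act index by index on the approximating sequences, so every estimate for the
-- polynomial can be made over ℚ.
seq-horner : ∀ {n} (as : Vec ℤ n) x k → seq (horner as x) k ≡ hornerℚ as (seq x k)
seq-horner []       x k = refl
seq-horner (a ∷ as) x k = cong₂ (λ b h → b ℚ.+ seq x k ℚ.* h) (int-def a) (seq-horner as x k)

hornerBound : ∀ {n} → Vec ℤ n → ℚ → ℚ
hornerBound []       R = 0ℚ
hornerBound (a ∷ as) R = ℚ.∣ int a ∣ ℚ.+ R ℚ.* hornerBound as R

-- `hornerBound` is the value at `R` of the polynomial whose coefficients are the absolute values;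
-- this is the derivative of that polynomial at `R`, by the product rule for a + y h(y).
lipschitz : ∀ {n} → Vec ℤ n → ℚ → ℚ
lipschitz []       R = 0ℚ
lipschitz (a ∷ as) R = R ℚ.* lipschitz as R ℚ.+ hornerBound as R

0≤hornerBound : ∀ {n} (as : Vec ℤ n) {R} → 0ℚ ℚ.≤ R → 0ℚ ℚ.≤ hornerBound as R
0≤hornerBound []       0≤R = ℚ.≤-refl
0≤hornerBound (a ∷ as) 0≤R = 0≤p+q (ℚ.0≤∣p∣ (int a)) (0≤p*q 0≤R (0≤hornerBound as 0≤R))

0≤lipschitz : ∀ {n} (as : Vec ℤ n) {R} → 0ℚ ℚ.≤ R → 0ℚ ℚ.≤ lipschitz as R
0≤lipschitz []       0≤R = ℚ.≤-refl
0≤lipschitz (a ∷ as) 0≤R = 0≤p+q (0≤p*q 0≤R (0≤lipschitz as 0≤R)) (0≤hornerBound as 0≤R)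

hornerℚ-bounded : ∀ {n} (as : Vec ℤ n) {R} y → 0ℚ ℚ.≤ R → ℚ.∣ y ∣ ℚ.≤ R →
                  ℚ.∣ hornerℚ as y ∣ ℚ.≤ hornerBound as R
hornerℚ-bounded []       y 0≤R y≤R = ℚ.≤-refl
hornerℚ-bounded (a ∷ as) {R} y 0≤R y≤R = begin
  ℚ.∣ int a ℚ.+ y ℚ.* h ∣                    ≤⟨ ℚ.∣p+q∣≤∣p∣+∣q∣ (int a) (y ℚ.* h) ⟩
  ℚ.∣ int a ∣ ℚ.+ ℚ.∣ y ℚ.* h ∣              ≡⟨ cong (ℚ.∣ int a ∣ ℚ.+_) (ℚ.∣p*q∣≡∣p∣*∣q∣ y h) ⟩
  ℚ.∣ int a ∣ ℚ.+ ℚ.∣ y ∣ ℚ.* ℚ.∣ h ∣        ≤⟨ ℚ.+-monoʳ-≤ ℚ.∣ int a ∣ (*-mono-≤ 0≤R (ℚ.0≤∣p∣ h) y≤R (hornerℚ-bounded as y 0≤R y≤R)) ⟩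
  ℚ.∣ int a ∣ ℚ.+ R ℚ.* hornerBound as R     ∎
  where
  open ℚ.≤-Reasoning
  h : ℚ
  h = hornerℚ as y

hornerℚ-lipschitz : ∀ {n} (as : Vec ℤ n) {R} y z → 0ℚ ℚ.≤ R → ℚ.∣ y ∣ ℚ.≤ R → ℚ.∣ z ∣ ℚ.≤ R →
                    ℚ.∣ hornerℚ as y ℚ.- hornerℚ as z ∣ ℚ.≤ lipschitz as R ℚ.* ℚ.∣ y ℚ.- z ∣
hornerℚ-lipschitz []       y z 0≤R y≤R z≤R = ℚ.≤-reflexive (sym (ℚ.*-zeroˡ ℚ.∣ y ℚ.- z ∣))
hornerℚ-lipschitz (a ∷ as) {R} y z 0≤R y≤R z≤R = begin
  ℚ.∣ (int a ℚ.+ y ℚ.* f) ℚ.- (int a ℚ.+ z ℚ.* g) ∣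
    ≡⟨ cong ℚ.∣_∣ (solve 5 (λ a y z f g → (a :+ y :* f) :- (a :+ z :* g) := y :* (f :- g) :+ g :* (y :- z)) refl (int a) y z f g) ⟩
  ℚ.∣ y ℚ.* (f ℚ.- g) ℚ.+ g ℚ.* (y ℚ.- z) ∣
    ≤⟨ ℚ.∣p+q∣≤∣p∣+∣q∣ (y ℚ.* (f ℚ.- g)) (g ℚ.* (y ℚ.- z)) ⟩
  ℚ.∣ y ℚ.* (f ℚ.- g) ∣ ℚ.+ ℚ.∣ g ℚ.* (y ℚ.- z) ∣
    ≡⟨ cong₂ ℚ._+_ (ℚ.∣p*q∣≡∣p∣*∣q∣ y (f ℚ.- g)) (ℚ.∣p*q∣≡∣p∣*∣q∣ g (y ℚ.- z)) ⟩
  ℚ.∣ y ∣ ℚ.* ℚ.∣ f ℚ.- g ∣ ℚ.+ ℚ.∣ g ∣ ℚ.* δ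
    ≤⟨ ℚ.+-mono-≤ (*-mono-≤ 0≤R (ℚ.0≤∣p∣ (f ℚ.- g)) y≤R (hornerℚ-lipschitz as y z 0≤R y≤R z≤R))
                  (*-monoʳ-≤ δ (ℚ.0≤∣p∣ (y ℚ.- z)) (hornerℚ-bounded as z 0≤R z≤R)) ⟩
  R ℚ.* (lipschitz as R ℚ.* δ) ℚ.+ hornerBound as R ℚ.* δ
    ≡⟨ solve 4 (λ r l b δ → r :* (l :* δ) :+ b :* δ := (r :* l :+ b) :* δ) refl R (lipschitz as R) (hornerBound as R) δ ⟩
  (R ℚ.* lipschitz as R ℚ.+ hornerBound as R) ℚ.* δ ∎
  where
  open ℚ.≤-Reasoning
  open ℚSolver.+-*-Solver
  f g δ : ℚ
  f = hornerℚ as y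
  g = hornerℚ as z
  δ = ℚ.∣ y ℚ.- z ∣

int≡[int*q^n]/q^n : ∀ i q n → int (i ℤ.* + (suc q ℕ.^ n)) ℚ.* recip q ^ n ≡ int i
int≡[int*q^n]/q^n i q n = begin
  int (i ℤ.* + (suc q ℕ.^ n)) ℚ.* recip q ^ n       ≡⟨ cong (ℚ._* recip q ^ n) (int-* i _) ⟩
  int i ℚ.* nat (suc q ℕ.^ n) ℚ.* recip q ^ n       ≡⟨ ℚ.*-assoc (int i) _ _ ⟩
  int i ℚ.* (nat (suc q ℕ.^ n) ℚ.* recip q ^ n)     ≡⟨ cong (int i ℚ.*_) (nat^*recip^ q n) ⟩
  int i ℚ.* 1ℚ                                      ≡⟨ ℚ.*-identityʳ _ ⟩
  int i                                             ∎
  where open ≡-Reasoning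

-- The induction starts at constant polynomials and not at the empty vector, which would cost one
-- more factor in the denominator; with that factor the series would converge only for τ > d + 2. As
-- in `recip`, `q` stands for the denominator `suc q`.
hornerℚ-denominator : ∀ {d} (as : Vec ℤ (suc d)) p q →
  ∃[ t ] hornerℚ as (int p ℚ.* recip q) ≡ int t ℚ.* recip q ^ d
hornerℚ-denominator (a ∷ []) p q = a , (begin
  int a ℚ.+ int p ℚ.* recip q ℚ.* 0ℚ      ≡⟨ cong (int a ℚ.+_) (ℚ.*-zeroʳ (int p ℚ.* recip q)) ⟩
  int a ℚ.+ 0ℚ                            ≡⟨ ℚ.+-identityʳ (int a) ⟩
  int a                                   ≡⟨ ℚ.*-identityʳ (int a) ⟨
  int a ℚ.* 1ℚ                            ∎)
  where open ≡-Reasoning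
hornerℚ-denominator {suc d} (a ∷ as@(_ ∷ _)) p q = a ℤ.* Q ℤ.+ p ℤ.* t , (begin
  int a ℚ.+ int p ℚ.* w ℚ.* hornerℚ as (int p ℚ.* w)
    ≡⟨ cong₂ (λ b h → b ℚ.+ int p ℚ.* w ℚ.* h) (sym (int≡[int*q^n]/q^n a q (suc d))) (proj₂ IH) ⟩
  int (a ℤ.* Q) ℚ.* (w ℚ.* w ^ d) ℚ.+ int p ℚ.* w ℚ.* (int t ℚ.* w ^ d)
    ≡⟨ solve 5 (λ b w u p t → b :* (w :* u) :+ p :* w :* (t :* u) := (b :+ p :* t) :* (w :* u)) refl
         (int (a ℤ.* Q)) w (w ^ d) (int p) (int t) ⟩
  (int (a ℤ.* Q) ℚ.+ int p ℚ.* int t) ℚ.* (w ℚ.* w ^ d)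
    ≡⟨ cong (λ s → (int (a ℤ.* Q) ℚ.+ s) ℚ.* (w ℚ.* w ^ d)) (int-* p t) ⟨
  (int (a ℤ.* Q) ℚ.+ int (p ℤ.* t)) ℚ.* (w ℚ.* w ^ d)
    ≡⟨ cong (ℚ._* (w ℚ.* w ^ d)) (int-+ (a ℤ.* Q) (p ℤ.* t)) ⟨
  int (a ℤ.* Q ℤ.+ p ℤ.* t) ℚ.* (w ℚ.* w ^ d) ∎)
  where
  open ≡-Reasoning
  open ℚSolver.+-*-Solver
  w : ℚ
  w = recip q
  IH : ∃[ t ] hornerℚ as (int p ℚ.* w) ≡ int t ℚ.* w ^ d
  IH = hornerℚ-denominator as p q
  t Q : ℤ
  t = proj₁ IH
  Q = + (suc q ℕ.^ suc d)

-- These are the centres of the cover. The degree is positive, so r / q can be expanded to the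
-- denominator of the polynomial value.
residual-denominator : ∀ {d} (as : Vec ℤ (suc (suc d))) p r q →
  ∃[ s ] int r ℚ.* recip q ℚ.- hornerℚ as (int p ℚ.* recip q) ≡ int s ℚ.* recip q ^ suc d
residual-denominator {d} as p r q = r ℤ.* Q ℤ.+ ℤ.- t , (begin
  int r ℚ.* w ℚ.- hornerℚ as (int p ℚ.* w)
    ≡⟨ cong₂ (λ b h → b ℚ.* w ℚ.- h) (sym (int≡[int*q^n]/q^n r q d)) (proj₂ T) ⟩
  int (r ℤ.* Q) ℚ.* w ^ d ℚ.* w ℚ.- int t ℚ.* (w ℚ.* w ^ d)
    ≡⟨ solve 4 (λ b w u t → b :* u :* w :- t :* (w :* u) := (b :+ :- t) :* (w :* u)) refl
         (int (r ℤ.* Q)) w (w ^ d) (int t) ⟩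
  (int (r ℤ.* Q) ℚ.+ ℚ.- int t) ℚ.* (w ℚ.* w ^ d)
    ≡⟨ cong (λ s → (int (r ℤ.* Q) ℚ.+ s) ℚ.* (w ℚ.* w ^ d)) (int-neg t) ⟨
  (int (r ℤ.* Q) ℚ.+ int (ℤ.- t)) ℚ.* (w ℚ.* w ^ d)
    ≡⟨ cong (ℚ._* (w ℚ.* w ^ d)) (int-+ (r ℤ.* Q) (ℤ.- t)) ⟨
  int (r ℤ.* Q ℤ.+ ℤ.- t) ℚ.* (w ℚ.* w ^ d) ∎)
  where
  open ≡-Reasoning
  open ℚSolver.+-*-Solver
  w : ℚ
  w = recip q
  T : ∃[ t ] hornerℚ as (int p ℚ.* w) ≡ int t ℚ.* w ^ suc d
  T = hornerℚ-denominator as p q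
  t Q : ℤ
  t = proj₁ T
  Q = + (suc q ℕ.^ d)

numerator-≤ : ∀ s q n K → ℚ.∣ int s ℚ.* recip q ^ n ∣ ℚ.≤ nat K → ℤ.∣ s ∣ ≤ K ℕ.* suc q ℕ.^ n
numerator-≤ s q n K h = nat-cancel-≤ (begin
  nat ℤ.∣ s ∣                                           ≡⟨ ℚ.*-identityʳ _ ⟨
  nat ℤ.∣ s ∣ ℚ.* 1ℚ                                    ≡⟨ cong (nat ℤ.∣ s ∣ ℚ.*_) (nat^*recip^ q n) ⟨
  nat ℤ.∣ s ∣ ℚ.* (nat (suc q ℕ.^ n) ℚ.* w)             ≡⟨ solve 3 (λ a b c → a :* (b :* c) := a :* c :* b) refl (nat ℤ.∣ s ∣) (nat (suc q ℕ.^ n)) w ⟩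
  nat ℤ.∣ s ∣ ℚ.* w ℚ.* nat (suc q ℕ.^ n)               ≡⟨ cong (ℚ._* nat (suc q ℕ.^ n)) (cong₂ ℚ._*_ (∣int∣ s) (ℚ.0≤p⇒∣p∣≡p (0≤p^n n (0≤recip q)))) ⟨
  ℚ.∣ int s ∣ ℚ.* ℚ.∣ w ∣ ℚ.* nat (suc q ℕ.^ n)         ≡⟨ cong (ℚ._* nat (suc q ℕ.^ n)) (ℚ.∣p*q∣≡∣p∣*∣q∣ (int s) w) ⟨
  ℚ.∣ int s ℚ.* w ∣ ℚ.* nat (suc q ℕ.^ n)               ≤⟨ *-monoʳ-≤ _ (0≤nat (suc q ℕ.^ n)) h ⟩
  nat K ℚ.* nat (suc q ℕ.^ n)                           ≡⟨ nat-* K (suc q ℕ.^ n) ⟨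
  nat (K ℕ.* suc q ℕ.^ n)                               ∎)
  where
  open ℚ.≤-Reasoning
  open ℚSolver.+-*-Solver
  w : ℚ
  w = recip q ^ n

-- The error splits as a - (u - P(z)) = (P(y) + a - u) - (P(y) - P(z)): the first part contributes
-- the 1, the second the Lipschitz constant. The slack `ε` is carried along because a strict
-- inequality between reals is witnessed by a uniform gap.
residual-close : ∀ {n} (as : Vec ℤ n) {R} y z a u {v ε} → 0ℚ ℚ.≤ R → ℚ.∣ y ∣ ℚ.≤ R → ℚ.∣ z ∣ ℚ.≤ R →
  ℚ.∣ y ℚ.- z ∣ ℚ.≤ v → ℚ.∣ (hornerℚ as y ℚ.+ a) ℚ.- u ∣ ℚ.+ ε ℚ.≤ v →
  ℚ.∣ a ℚ.- (u ℚ.- hornerℚ as z) ∣ ℚ.+ ε ℚ.≤ (lipschitz as R ℚ.+ 1ℚ) ℚ.* v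
residual-close as {R} y z a u {v} {ε} 0≤R y≤R z≤R yz au = begin
  ℚ.∣ a ℚ.- (u ℚ.- g) ∣ ℚ.+ ε
    ≡⟨ cong (λ s → ℚ.∣ s ∣ ℚ.+ ε) (solve 4 (λ a u f g → a :- (u :- g) := ((f :+ a) :- u) :- (f :- g)) refl a u f g) ⟩
  ℚ.∣ ((f ℚ.+ a) ℚ.- u) ℚ.- (f ℚ.- g) ∣ ℚ.+ ε
    ≤⟨ ℚ.+-monoˡ-≤ ε (ℚ.∣p-q∣≤∣p∣+∣q∣ ((f ℚ.+ a) ℚ.- u) (f ℚ.- g)) ⟩
  (A′ ℚ.+ ℚ.∣ f ℚ.- g ∣) ℚ.+ ε
    ≡⟨ solve 3 (λ a b e → (a :+ b) :+ e := b :+ (a :+ e)) refl A′ ℚ.∣ f ℚ.- g ∣ ε ⟩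
  ℚ.∣ f ℚ.- g ∣ ℚ.+ (A′ ℚ.+ ε)
    ≤⟨ ℚ.+-mono-≤ (ℚ.≤-trans (hornerℚ-lipschitz as y z 0≤R y≤R z≤R) (*-monoˡ-≤ C (0≤lipschitz as 0≤R) yz)) au ⟩
  C ℚ.* v ℚ.+ v
    ≡⟨ cong (C ℚ.* v ℚ.+_) (ℚ.*-identityˡ v) ⟨
  C ℚ.* v ℚ.+ 1ℚ ℚ.* v
    ≡⟨ ℚ.*-distribʳ-+ v C 1ℚ ⟨
  (C ℚ.+ 1ℚ) ℚ.* v ∎
  where
  open ℚ.≤-Reasoning
  open ℚSolver.+-*-Solver
  f g C A′ : ℚ
  f = hornerℚ as y
  g = hornerℚ as z
  C = lipschitz as R
  A′ = ℚ.∣ (f ℚ.+ a) ℚ.- u ∣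

-- Balls as intervals with rational endpoints

ball : ℚ → ∀ ρ → 0ℚ ℚ.≤ ρ → Interval
ball c ρ 0≤ρ = interval (c ℚ.- ρ) (c ℚ.+ ρ) (begin
  c ℚ.- ρ          ≤⟨ ℚ.+-monoʳ-≤ c (ℚ.neg-antimono-≤ 0≤ρ) ⟩
  c ℚ.+ 0ℚ         ≤⟨ ℚ.+-monoʳ-≤ c 0≤ρ ⟩
  c ℚ.+ ρ          ∎)
  where open ℚ.≤-Reasoning

width-ball : ∀ c ρ 0≤ρ → width (ball c ρ 0≤ρ) ≡ ρ ℚ.+ ρ
width-ball c ρ _ = solve 2 (λ c r → (c :+ r) :- (c :- r) := r :+ r) refl c ρ
  where open ℚSolver.+-*-Solver

ball-∋ᴿ : ∀ c ρ 0≤ρ α ε → 0ℚ ℚ.< ε → ∀ N → (∀ n → N ≤ n → ℚ.∣ seq α n ℚ.- c ∣ ℚ.+ ε ℚ.≤ ρ) →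
          ball c ρ 0≤ρ ∋ᴿ α
ball-∋ᴿ c ρ _ α ε 0<ε N close =
  (ε , 0<ε , N , λ n N≤n → below (seq α n) (close n N≤n)) ,
  (ε , 0<ε , N , λ n N≤n → above (seq α n) (close n N≤n))
  where
  open ℚ.≤-Reasoning
  open ℚSolver.+-*-Solver
  above : ∀ a → ℚ.∣ a ℚ.- c ∣ ℚ.+ ε ℚ.≤ ρ → a ℚ.+ ε ℚ.≤ c ℚ.+ ρ
  above a h = begin
    a ℚ.+ ε                               ≤⟨ ℚ.+-monoˡ-≤ ε (p≤q+∣p-q∣ a c) ⟩
    (c ℚ.+ ℚ.∣ a ℚ.- c ∣) ℚ.+ ε           ≡⟨ ℚ.+-assoc c _ _ ⟩
    c ℚ.+ (ℚ.∣ a ℚ.- c ∣ ℚ.+ ε)           ≤⟨ ℚ.+-monoʳ-≤ c h ⟩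
    c ℚ.+ ρ                               ∎
  below : ∀ a → ℚ.∣ a ℚ.- c ∣ ℚ.+ ε ℚ.≤ ρ → (c ℚ.- ρ) ℚ.+ ε ℚ.≤ a
  below a h = begin
    (c ℚ.- ρ) ℚ.+ ε                       ≤⟨ ℚ.+-monoˡ-≤ ε (ℚ.+-monoˡ-≤ (ℚ.- ρ) (p≤q+∣p-q∣ c a)) ⟩
    ((a ℚ.+ ℚ.∣ c ℚ.- a ∣) ℚ.- ρ) ℚ.+ ε   ≡⟨ cong (λ s → ((a ℚ.+ s) ℚ.- ρ) ℚ.+ ε) (∣p-q∣≡∣q-p∣ c a) ⟩
    ((a ℚ.+ ℚ.∣ a ℚ.- c ∣) ℚ.- ρ) ℚ.+ ε   ≡⟨ solve 4 (λ a b r e → ((a :+ b) :- r) :+ e := a :+ ((b :+ e) :- r)) refl a ℚ.∣ a ℚ.- c ∣ ρ ε ⟩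
    a ℚ.+ ((ℚ.∣ a ℚ.- c ∣ ℚ.+ ε) ℚ.- ρ)   ≤⟨ ℚ.+-monoʳ-≤ a (ℚ.+-monoˡ-≤ (ℚ.- ρ) h) ⟩
    a ℚ.+ (ρ ℚ.- ρ)                       ≡⟨ cong (a ℚ.+_) (ℚ.+-inverseʳ ρ) ⟩
    a ℚ.+ 0ℚ                              ≡⟨ ℚ.+-identityʳ a ⟩
    a                                     ∎

-- Blocks of denominators

-- The search walks up from `i` to the first crossing; `n` is the fuel that makes it structural.
bracket : ∀ (f : ℕ → ℕ) n i q → f i ≤ q → q ℕ.< f (i + n) → ∃[ j ] i ≤ j × f j ≤ q × q ℕ.< f (suc j)
bracket f zero    i q fi≤q q<fi =
  contradiction (subst (λ k → q ℕ.< f k) (ℕ.+-identityʳ i) q<fi) (ℕ.≤⇒≯ fi≤q)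
bracket f (suc n) i q fi≤q q<f with q ℕ.<? f (suc i)
... | yes q<f′ = i , ℕ.≤-refl , fi≤q , q<f′
... | no  q≮f′ =
  let j , i<j , h = bracket f n (suc i) q (ℕ.≮⇒≥ q≮f′) (subst (λ k → q ℕ.< f k) (ℕ.+-suc i n) q<f)
  in j , ℕ.<⇒≤ i<j , h

-- Zero is listed twice, which keeps the length simple; the estimate of the total width absorbs the
-- surplus.
ints : ℕ → List ℤ
ints B = map +_ (upTo (suc B)) ++ map (λ n → ℤ.- + n) (upTo (suc B))

∈-ints : ∀ B i → ℤ.∣ i ∣ ≤ B → i ∈ ints B
∈-ints B (+ n)    h = ∈-++⁺ˡ (∈-map⁺ +_ (∈-upTo⁺ (ℕ.s≤s h)))
∈-ints B -[1+ n ] h = ∈-++⁺ʳ (map +_ (upTo (suc B))) (∈-map⁺ (λ n → ℤ.- + n) (∈-upTo⁺ (ℕ.s≤s h)))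

length-ints : ∀ B → length (ints B) ≡ suc B + suc B
length-ints B = trans (length-++ (map +_ (upTo (suc B))))
  (cong₂ _+_ (trans (length-map +_ (upTo (suc B))) (length-upTo (suc B)))
             (trans (length-map (λ n → ℤ.- + n) (upTo (suc B))) (length-upTo (suc B))))

length-cartesianProduct : ∀ {A B : Set} (xs : List A) (ys : List B) →
  length (cartesianProduct xs ys) ≡ length xs ℕ.* length ys
length-cartesianProduct []       ys = refl
length-cartesianProduct (x ∷ xs) ys = trans (length-++ (map (x ,_) ys))
  (cong₂ _+_ (length-map (x ,_) ys) (length-cartesianProduct xs ys))

totalWidth-map : ∀ {A : Set} (f : A → Interval) w → (∀ x → width (f x) ≡ w) →
  ∀ xs → totalWidth (map f xs) ≡ nat (length xs) ℚ.* w
totalWidth-map f w eq []       = sym (trans (cong (ℚ._* w) nat0≡0) (ℚ.*-zeroˡ w))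
totalWidth-map f w eq (x ∷ xs) = begin
  width (f x) ℚ.+ totalWidth (map f xs)       ≡⟨ cong₂ ℚ._+_ (trans (eq x) (sym (ℚ.*-identityˡ w))) (totalWidth-map f w eq xs) ⟩
  1ℚ ℚ.* w ℚ.+ nat (length xs) ℚ.* w          ≡⟨ ℚ.*-distribʳ-+ w 1ℚ (nat (length xs)) ⟨
  (1ℚ ℚ.+ nat (length xs)) ℚ.* w              ≡⟨ cong (λ u → (u ℚ.+ nat (length xs)) ℚ.* w) nat1≡1 ⟨
  (nat 1 ℚ.+ nat (length xs)) ℚ.* w           ≡⟨ cong (ℚ._* w) (int-+ (+ 1) (+ length xs)) ⟨
  nat (suc (length xs)) ℚ.* w                 ∎
  where open ≡-Reasoning

-- `scaledPower` reads its exponent `- r` through `pos` and `neg`, but negation on ℚ computes only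
-- once the shape of the numerator is known; hence the case distinctions here and in the next two
-- lemmas.
pos-numerator-neg≡0 : ∀ r → 0ℚ ℚ.≤ r → pos (↥ (ℚ.- r)) ≡ 0
pos-numerator-neg≡0 (ℚ.mkℚ (+ zero)  _ _) h = refl
pos-numerator-neg≡0 (ℚ.mkℚ (+ suc _) _ _) h = refl
pos-numerator-neg≡0 (ℚ.mkℚ -[1+ _ ]  _ _) h = contradiction (ℚ.drop-*≤* h) λ ()

neg-numerator : ∀ r → 0ℚ ℚ.≤ r → + neg (↥ (ℚ.- r)) ≡ ↥ r
neg-numerator (ℚ.mkℚ (+ zero)  _ _) h = refl
neg-numerator (ℚ.mkℚ (+ suc _) _ _) h = refl
neg-numerator (ℚ.mkℚ -[1+ _ ]  _ _) h = contradiction (ℚ.drop-*≤* h) λ ()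

neg-denominator : ∀ r → ↧ₙ (ℚ.- r) ≡ ↧ₙ r
neg-denominator (ℚ.mkℚ (+ zero)  _ _) = refl
neg-denominator (ℚ.mkℚ (+ suc _) _ _) = refl
neg-denominator (ℚ.mkℚ -[1+ _ ]  _ _) = refl

exponent-≥ : ∀ D M r → nat D ℚ.+ recip M ℚ.≤ r → 0ℚ ℚ.≤ r →
  (D ℕ.* suc M + 1) ℕ.* ↧ₙ (ℚ.- r) ≤ neg (↥ (ℚ.- r)) ℕ.* suc M
exponent-≥ D M r@record{} h 0≤r = ℤ.drop‿+≤+ (subst₂ ℤ._≤_ lhs rhs cleared)
  where
  cleared : (+ D ℤ.* + suc M ℤ.+ + 1 ℤ.* + 1) ℤ.* ↧ r ℤ.≤ ↥ r ℤ.* (+ 1 ℤ.* + suc M)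
  cleared = ℚᵘ.drop-*≤* (ℚᵘ.≤-respˡ-≃
    (ℚᵘ.≃-trans (ℚ.toℚᵘ-homo-+ (nat D) (recip M)) (ℚᵘ.+-cong (toℚᵘ-int (+ D)) (toℚᵘ-recip M)))
    (ℚ.toℚᵘ-mono-≤ h))
  lhs : (+ D ℤ.* + suc M ℤ.+ + 1 ℤ.* + 1) ℤ.* ↧ r ≡ + ((D ℕ.* suc M + 1) ℕ.* ↧ₙ (ℚ.- r))
  lhs = begin
    (+ D ℤ.* + suc M ℤ.+ + 1) ℤ.* + ↧ₙ r      ≡⟨ cong (λ i → (i ℤ.+ + 1) ℤ.* + ↧ₙ r) (ℤ.pos-* D (suc M)) ⟨
    + (D ℕ.* suc M + 1) ℤ.* + ↧ₙ r            ≡⟨ ℤ.pos-* (D ℕ.* suc M + 1) (↧ₙ r) ⟨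
    + ((D ℕ.* suc M + 1) ℕ.* ↧ₙ r)            ≡⟨ cong (λ n → + ((D ℕ.* suc M + 1) ℕ.* n)) (neg-denominator r) ⟨
    + ((D ℕ.* suc M + 1) ℕ.* ↧ₙ (ℚ.- r))      ∎
    where open ≡-Reasoning
  rhs : ↥ r ℤ.* (+ 1 ℤ.* + suc M) ≡ + (neg (↥ (ℚ.- r)) ℕ.* suc M)
  rhs = trans (cong₂ ℤ._*_ (sym (neg-numerator r 0≤r)) (ℤ.*-identityˡ (+ suc M)))
    (sym (ℤ.pos-* (neg (↥ (ℚ.- r))) (suc M)))

-- Block j consists of the denominators in [2 ^ (j m), 2 ^ ((j + 1) m)) with
-- m = 3 (M + 1).  If τ ≥ D + 1 / (M + 1), then m τ ≥ m D + 3, so q ^ -τ is at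
-- most 2 ^ -(j (m D + 3)) there.  Of the spare factor 2 ^ -3j one third pays
-- for the radius, one for the range of the centres, and one for convergence.
period : ℕ → ℕ
period M = 3 ℕ.* suc M

blockStart : ℕ → ℕ → ℕ
blockStart M j = 2 ℕ.^ (j ℕ.* period M)

blockExponent : ℕ → ℕ → ℕ → ℕ
blockExponent D M j = j ℕ.* (period M ℕ.* D + 3)

-- With `- r` equal to -a / b, the inequality that defines `scaledPower` reads k ^ b · q ^ a ≤ n ^
-- b. As q ^ a is at least (2 ^ E) ^ b, comparing b-th powers suffices and no root is taken.
scaledPower-small : ∀ D M j q r n → nat D ℚ.+ recip M ℚ.≤ r → blockStart M j ≤ q →
  scaledPower q (ℚ.- r) n ℕ.* 2 ℕ.^ blockExponent D M j ≤ n
scaledPower-small D M j q r n D≤r Q≤q = ℕ.≮⇒≥ λ n< → ℕ.<⇒≱ (ℕ.^-monoˡ-< b {{b≢0 (ℚ.- r)}} n<) (begin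
  (k ℕ.* 2 ℕ.^ E) ℕ.^ b           ≡⟨ *-^-distrib k (2 ℕ.^ E) b ⟩
  k ℕ.^ b ℕ.* (2 ℕ.^ E) ℕ.^ b     ≤⟨ ℕ.*-monoʳ-≤ (k ℕ.^ b) power-≤ ⟩
  k ℕ.^ b ℕ.* q ℕ.^ a             ≤⟨ scaledPower-below q (ℚ.- r) n ⟩
  q ℕ.^ pos (↥ (ℚ.- r)) ℕ.* n ℕ.^ b ≡⟨ cong (λ e → q ℕ.^ e ℕ.* n ℕ.^ b) (pos-numerator-neg≡0 r 0≤r) ⟩
  1 ℕ.* n ℕ.^ b                   ≡⟨ ℕ.*-identityˡ _ ⟩
  n ℕ.^ b                         ∎)
  where
  open ℕ.≤-Reasoning
  open ℕSolver.+-*-Solver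
  a b k E : ℕ
  a = neg (↥ (ℚ.- r))
  b = ↧ₙ (ℚ.- r)
  k = scaledPower q (ℚ.- r) n
  E = blockExponent D M j
  b≢0 : ∀ p → ℕ.NonZero (↧ₙ p)
  b≢0 record{} = _
  0≤r : 0ℚ ℚ.≤ r
  0≤r = ℚ.≤-trans (0≤p+q (0≤nat D) (0≤recip M)) D≤r
  power-≤ : (2 ℕ.^ E) ℕ.^ b ≤ q ℕ.^ a
  power-≤ = begin
    (2 ℕ.^ E) ℕ.^ b                    ≡⟨ ℕ.^-*-assoc 2 E b ⟩
    -- The factor 3 in `period` makes the block exponent 3j (D (M + 1) + 1), the form that
    -- `exponent-≥` bounds.
    2 ℕ.^ (E ℕ.* b)                    ≡⟨ cong (2 ℕ.^_) (solve 4 (λ j m d b → j :* (con 3 :* m :* d :+ con 3) :* b := con 3 :* j :* ((d :* m :+ con 1) :* b)) refl j (suc M) D b) ⟩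
    2 ℕ.^ (3 ℕ.* j ℕ.* ((D ℕ.* suc M + 1) ℕ.* b))  ≤⟨ ℕ.^-monoʳ-≤ 2 (ℕ.*-monoʳ-≤ (3 ℕ.* j) (exponent-≥ D M r D≤r 0≤r)) ⟩
    2 ℕ.^ (3 ℕ.* j ℕ.* (a ℕ.* suc M))  ≡⟨ cong (2 ℕ.^_) (solve 3 (λ j a m → con 3 :* j :* (a :* m) := j :* (con 3 :* m) :* a) refl j a (suc M)) ⟩
    2 ℕ.^ (j ℕ.* period M ℕ.* a)       ≡⟨ ℕ.^-*-assoc 2 (j ℕ.* period M) a ⟨
    blockStart M j ℕ.^ a               ≤⟨ ℕ.^-monoˡ-≤ a Q≤q ⟩
    q ℕ.^ a                            ∎

fraction-small : ∀ k E n → k ℕ.* 2 ℕ.^ E ≤ suc n → + k / suc n ℚ.≤ half ^ E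
fraction-small k E n h = begin
  + k / suc n                                            ≡⟨ /≡int*recip (+ k) n ⟩
  nat k ℚ.* w                                            ≡⟨ ℚ.*-identityʳ _ ⟨
  nat k ℚ.* w ℚ.* 1ℚ                                     ≡⟨ cong (nat k ℚ.* w ℚ.*_) (2^n*half^n E) ⟨
  nat k ℚ.* w ℚ.* (nat (2 ℕ.^ E) ℚ.* v)                  ≡⟨ solve 4 (λ k w p v → k :* w :* (p :* v) := k :* p :* (w :* v)) refl (nat k) w (nat (2 ℕ.^ E)) v ⟩
  nat k ℚ.* nat (2 ℕ.^ E) ℚ.* (w ℚ.* v)                  ≡⟨ cong (ℚ._* (w ℚ.* v)) (nat-* k (2 ℕ.^ E)) ⟨
  nat (k ℕ.* 2 ℕ.^ E) ℚ.* (w ℚ.* v)                      ≤⟨ *-monoʳ-≤ (w ℚ.* v) (0≤p*q (0≤recip n) (0≤half^ E)) (nat-mono-≤ h) ⟩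
  nat (suc n) ℚ.* (w ℚ.* v)                              ≡⟨ ℚ.*-assoc (nat (suc n)) w v ⟨
  nat (suc n) ℚ.* w ℚ.* v                                ≡⟨ cong (ℚ._* v) (nat*recip n) ⟩
  1ℚ ℚ.* v                                               ≡⟨ ℚ.*-identityˡ v ⟩
  v                                                      ∎
  where
  open ℚ.≤-Reasoning
  open ℚSolver.+-*-Solver
  w v : ℚ
  w = recip n
  v = half ^ E

-- The bound holds at each such index and not only in the limit, because the approximations to a
-- power are rounded down.
power-small : ∀ D M j q τ n → nat D ℚ.+ recip M ℚ.≤ seq τ n → blockStart M j ≤ suc q →
  seq (suc q ^ᴿ (-ᴿ τ)) n ℚ.≤ half ^ blockExponent D M j
power-small D M j q τ n D≤τ Q≤q =
  fraction-small (scaledPower (suc q) (ℚ.- seq τ n) (suc n)) (blockExponent D M j) n (scaledPower-small D M j (suc q) (seq τ n) (suc n) D≤τ Q≤q)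

-- The factors 2 ^ j here and in the radius eventually exceed every constant
-- that depends on x and α, so a single sequence of blocks serves all of them.
numeratorBound : ℕ → ℕ → ℕ → ℕ
numeratorBound d M j = 2 ℕ.^ j ℕ.* blockStart M (suc j) ℕ.^ d

radius : ℕ → ℕ → ℕ → ℚ
radius d M j = nat (2 ℕ.^ j) ℚ.* half ^ blockExponent (suc d) M j

0≤radius : ∀ d M j → 0ℚ ℚ.≤ radius d M j
0≤radius d M j = 0≤p*q (0≤nat (2 ℕ.^ j)) (0≤half^ (blockExponent (suc d) M j))

-- The pair (q , s) stands for the fraction s / (q + 1) ^ d.
rationalBall : ∀ d M j → ℕ × ℤ → Interval
rationalBall d M j (q , s) = ball (int s ℚ.* recip q ^ d) (radius d M j) (0≤radius d M j)

-- All denominators up to the end of the block are listed, not only those inside it; this costs no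
-- more than a constant factor.
block : ℕ → ℕ → ℕ → List Interval
block d M j = map (rationalBall d M j)
  (cartesianProduct (upTo (blockStart M (suc j))) (ints (numeratorBound d M j)))

-- The number of numerators is rounded up to a power of 2, so that the rest is arithmetic of
-- exponents.
block-count : ∀ d M j →
  blockStart M (suc j) ℕ.* (suc (numeratorBound d M j) + suc (numeratorBound d M j)) ≤
  blockStart M (suc j) ℕ.* (4 ℕ.* numeratorBound d M j)
block-count d M j = ℕ.*-monoʳ-≤ (blockStart M (suc j)) (begin
  suc S + suc S          ≤⟨ ℕ.+-mono-≤ 1+S≤S+S 1+S≤S+S ⟩
  (S + S) + (S + S)      ≡⟨ solve 1 (λ s → (s :+ s) :+ (s :+ s) := con 4 :* s) refl S ⟩
  4 ℕ.* S                ∎)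
  where
  open ℕ.≤-Reasoning
  open ℕSolver.+-*-Solver
  S : ℕ
  S = numeratorBound d M j
  1+S≤S+S : suc S ≤ S + S
  1+S≤S+S = ℕ.+-monoˡ-≤ S (ℕ.*-mono-≤ (ℕ.m^n>0 2 j)
    (ℕ.m^n>0 (blockStart M (suc j)) {{ℕ.m^n≢0 2 (suc j ℕ.* period M)}} d))

-- The 3 comes from the factor 4 in the count and the factor 2 between radius and width; the summand
-- `period M ℕ.* suc d` comes from measuring the block at its end, at j + 1, while the radius is
-- measured at j.
block-exponents : ∀ d M j →
  blockStart M (suc j) ℕ.* (4 ℕ.* numeratorBound d M j) ℕ.* (2 ℕ.* 2 ℕ.^ j) ≡
  2 ℕ.^ (3 + period M ℕ.* suc d) ℕ.* 2 ℕ.^ (j ℕ.* (period M ℕ.* suc d + 2))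
block-exponents d M j = begin
  2 ℕ.^ e ℕ.* (4 ℕ.* (2 ℕ.^ j ℕ.* (2 ℕ.^ e) ℕ.^ d)) ℕ.* (2 ℕ.* 2 ℕ.^ j)
    ≡⟨ cong (λ x → 2 ℕ.^ e ℕ.* (4 ℕ.* (2 ℕ.^ j ℕ.* x)) ℕ.* (2 ℕ.* 2 ℕ.^ j)) (ℕ.^-*-assoc 2 e d) ⟩
  2 ℕ.^ e ℕ.* (4 ℕ.* (2 ℕ.^ j ℕ.* 2 ℕ.^ (e ℕ.* d))) ℕ.* (2 ℕ.* 2 ℕ.^ j)
    ≡⟨ solve 3 (λ x y z → x :* (con 4 :* (y :* z)) :* (con 2 :* y) := con 8 :* ((x :* z) :* (y :* y))) refl
         (2 ℕ.^ e) (2 ℕ.^ j) (2 ℕ.^ (e ℕ.* d)) ⟩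
  2 ℕ.^ 3 ℕ.* ((2 ℕ.^ e ℕ.* 2 ℕ.^ (e ℕ.* d)) ℕ.* (2 ℕ.^ j ℕ.* 2 ℕ.^ j))
    ≡⟨ cong (2 ℕ.^ 3 ℕ.*_) (cong₂ ℕ._*_ (ℕ.^-distribˡ-+-* 2 e (e ℕ.* d)) (ℕ.^-distribˡ-+-* 2 j j)) ⟨
  2 ℕ.^ 3 ℕ.* (2 ℕ.^ (e + e ℕ.* d) ℕ.* 2 ℕ.^ (j + j))
    ≡⟨ cong (2 ℕ.^ 3 ℕ.*_) (ℕ.^-distribˡ-+-* 2 (e + e ℕ.* d) (j + j)) ⟨
  2 ℕ.^ 3 ℕ.* 2 ℕ.^ (e + e ℕ.* d + (j + j))
    ≡⟨ ℕ.^-distribˡ-+-* 2 3 (e + e ℕ.* d + (j + j)) ⟨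
  2 ℕ.^ (3 + (e + e ℕ.* d + (j + j)))
    ≡⟨ cong (2 ℕ.^_) (solve 3 (λ j m d →
         con 3 :+ ((con 1 :+ j) :* m :+ (con 1 :+ j) :* m :* d :+ (j :+ j))
         := con 3 :+ m :* (con 1 :+ d) :+ j :* (m :* (con 1 :+ d) :+ con 2)) refl j (period M) d) ⟩
  2 ℕ.^ (3 + period M ℕ.* suc d + j ℕ.* (period M ℕ.* suc d + 2))
    ≡⟨ ℕ.^-distribˡ-+-* 2 (3 + period M ℕ.* suc d) (j ℕ.* (period M ℕ.* suc d + 2)) ⟩
  2 ℕ.^ (3 + period M ℕ.* suc d) ℕ.* 2 ℕ.^ (j ℕ.* (period M ℕ.* suc d + 2)) ∎
  where
  open ≡-Reasoning
  open ℕSolver.+-*-Solver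
  e : ℕ
  e = suc j ℕ.* period M

blockConstant : ℕ → ℕ → ℚ
blockConstant d M = nat (2 ℕ.^ (3 + period M ℕ.* suc d))

0≤blockConstant : ∀ d M → 0ℚ ℚ.≤ blockConstant d M
0≤blockConstant d M = 0≤nat (2 ℕ.^ (3 + period M ℕ.* suc d))

totalWidth-block : ∀ d M j → totalWidth (block d M j) ℚ.≤ blockConstant d M ℚ.* half ^ j
totalWidth-block d M j = begin
  totalWidth (block d M j)
    ≡⟨ totalWidth-map (rationalBall d M j) (ρ ℚ.+ ρ)
         (λ (q , s) → width-ball (int s ℚ.* recip q ^ d) ρ (0≤radius d M j))
         (cartesianProduct (upTo X) (ints S)) ⟩
  nat (length (cartesianProduct (upTo X) (ints S))) ℚ.* (ρ ℚ.+ ρ)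
    ≡⟨ cong (λ n → nat n ℚ.* (ρ ℚ.+ ρ)) (trans (length-cartesianProduct (upTo X) (ints S)) (cong₂ ℕ._*_ (length-upTo X) (length-ints S))) ⟩
  nat (X ℕ.* (suc S + suc S)) ℚ.* (ρ ℚ.+ ρ)
    ≤⟨ *-monoʳ-≤ (ρ ℚ.+ ρ) (0≤p+q (0≤radius d M j) (0≤radius d M j)) (nat-mono-≤ (block-count d M j)) ⟩
  nat (X ℕ.* (4 ℕ.* S)) ℚ.* (ρ ℚ.+ ρ)
    ≡⟨ cong (nat (X ℕ.* (4 ℕ.* S)) ℚ.*_) (p+p≡nat2*p ρ) ⟩
  nat (X ℕ.* (4 ℕ.* S)) ℚ.* (nat 2 ℚ.* (nat (2 ℕ.^ j) ℚ.* v))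
    ≡⟨ solve 4 (λ a b c v → a :* (b :* (c :* v)) := a :* (b :* c) :* v) refl (nat (X ℕ.* (4 ℕ.* S))) (nat 2) (nat (2 ℕ.^ j)) v ⟩
  nat (X ℕ.* (4 ℕ.* S)) ℚ.* (nat 2 ℚ.* nat (2 ℕ.^ j)) ℚ.* v
    ≡⟨ cong (λ x → nat (X ℕ.* (4 ℕ.* S)) ℚ.* x ℚ.* v) (nat-* 2 (2 ℕ.^ j)) ⟨
  nat (X ℕ.* (4 ℕ.* S)) ℚ.* nat (2 ℕ.* 2 ℕ.^ j) ℚ.* v
    ≡⟨ cong (ℚ._* v) (nat-* (X ℕ.* (4 ℕ.* S)) (2 ℕ.* 2 ℕ.^ j)) ⟨
  nat (X ℕ.* (4 ℕ.* S) ℕ.* (2 ℕ.* 2 ℕ.^ j)) ℚ.* v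
    -- The exponent in the radius is `G + j`: `G` cancels against the count, and the spare `j` is
    -- the geometric decay.
    ≡⟨ cong₂ (λ n e → nat n ℚ.* half ^ e) (block-exponents d M j)
         (trans (cong (j ℕ.*_) (sym (ℕ.+-assoc (period M ℕ.* suc d) 2 1)))
           (trans (ℕ.*-distribˡ-+ j (period M ℕ.* suc d + 2) 1) (cong (_+_ G) (ℕ.*-identityʳ j)))) ⟩
  nat (2 ℕ.^ F ℕ.* 2 ℕ.^ G) ℚ.* half ^ (G + j)
    ≡⟨ cong₂ ℚ._*_ (nat-* (2 ℕ.^ F) (2 ℕ.^ G)) (^-homo-* half G j) ⟩
  nat (2 ℕ.^ F) ℚ.* nat (2 ℕ.^ G) ℚ.* (half ^ G ℚ.* half ^ j)
    ≡⟨ solve 4 (λ a b c d → a :* b :* (c :* d) := a :* ((b :* c) :* d)) refl (nat (2 ℕ.^ F)) (nat (2 ℕ.^ G)) (half ^ G) (half ^ j) ⟩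
  nat (2 ℕ.^ F) ℚ.* (nat (2 ℕ.^ G) ℚ.* half ^ G ℚ.* half ^ j)
    ≡⟨ cong (λ x → nat (2 ℕ.^ F) ℚ.* (x ℚ.* half ^ j)) (2^n*half^n G) ⟩
  nat (2 ℕ.^ F) ℚ.* (1ℚ ℚ.* half ^ j)
    ≡⟨ cong (nat (2 ℕ.^ F) ℚ.*_) (ℚ.*-identityˡ (half ^ j)) ⟩
  blockConstant d M ℚ.* half ^ j ∎
  where
  open ℚ.≤-Reasoning
  open ℚSolver.+-*-Solver
  X S F G : ℕ
  X = blockStart M (suc j)
  S = numeratorBound d M j
  F = 3 + period M ℕ.* suc d
  G = j ℕ.* (period M ℕ.* suc d + 2)
  ρ v : ℚ
  ρ = radius d M j
  v = half ^ blockExponent (suc d) M j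

-- Covering the exceptional set

p≤p+ε : ∀ p {ε} → 0ℚ ℚ.< ε → p ℚ.≤ p ℚ.+ ε
p≤p+ε p 0<ε = ℚ.≤-trans (ℚ.≤-reflexive (sym (ℚ.+-identityʳ p))) (ℚ.+-monoʳ-≤ p (ℚ.<⇒≤ 0<ε))

∣∣-≤-via : ∀ p q {b c} → ℚ.∣ q ℚ.- p ∣ ℚ.≤ b → ℚ.∣ q ∣ ℚ.≤ c → ℚ.∣ p ∣ ℚ.≤ b ℚ.+ c
∣∣-≤-via p q h k = ℚ.≤-trans (∣p∣≤∣p-q∣+∣q∣ p q)
  (ℚ.+-mono-≤ (ℚ.≤-trans (ℚ.≤-reflexive (∣p-q∣≡∣q-p∣ p q)) h) k)

fraction-numerator-≤ : ∀ s q K → ℚ.∣ int s ℚ.* recip q ∣ ℚ.≤ nat K → ℤ.∣ s ∣ ≤ K ℕ.* suc q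
fraction-numerator-≤ s q K h = subst (λ n → ℤ.∣ s ∣ ≤ K ℕ.* n) (ℕ.*-identityʳ (suc q))
  (numerator-≤ s q 1 K (subst (λ w → ℚ.∣ int s ℚ.* w ∣ ℚ.≤ nat K) (sym (ℚ.*-identityʳ (recip q))) h))

-- The gap is kept in the second bound only: it later places α strictly inside an interval, while
-- the first bound just feeds the Lipschitz estimate.
approximation-bounds : ∀ {d} (P : Polynomial d) D M τ Nτ →
  (∀ n → Nτ ≤ n → nat D ℚ.+ recip M ℚ.≤ seq τ n) →
  ∀ x α p r q j → blockStart M j ≤ suc q →
  Approximates τ (shift P α) x (p , r , suc q) →
  ∃[ ε ] 0ℚ ℚ.< ε × ∃[ N ] ∀ n → N ≤ n →
    ℚ.∣ seq x n ℚ.- int p ℚ.* recip q ∣ ℚ.≤ half ^ blockExponent D M j ×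
    ℚ.∣ (hornerℚ (coefficients P) (seq x n) ℚ.+ seq α n) ℚ.- int r ℚ.* recip q ∣ ℚ.+ ε ℚ.≤ half ^ blockExponent D M j
approximation-bounds P D M τ Nτ D≤τ x α p r q j Q≤q ((δ , 0<δ , N₁ , h₁) , (ε , 0<ε , N₂ , h₂)) =
  ε , 0<ε , Nτ ℕ.⊔ (N₁ ℕ.⊔ N₂) , λ n N≤n →
    let Nτ≤n = ℕ.m⊔n≤o⇒m≤o Nτ (N₁ ℕ.⊔ N₂) N≤n
        N₁₂≤n = ℕ.m⊔n≤o⇒n≤o Nτ (N₁ ℕ.⊔ N₂) N≤n
        small = power-small D M j q τ n (D≤τ n Nτ≤n) Q≤q
    in first n (h₁ n (ℕ.m⊔n≤o⇒m≤o N₁ N₂ N₁₂≤n)) small , second n (h₂ n (ℕ.m⊔n≤o⇒n≤o N₁ N₂ N₁₂≤n)) small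
  where
  open ℚ.≤-Reasoning
  v : ℚ
  v = half ^ blockExponent D M j
  first : ∀ n {u} → ℚ.∣ seq x n ℚ.- p / suc q ∣ ℚ.+ δ ℚ.≤ u → u ℚ.≤ v →
          ℚ.∣ seq x n ℚ.- int p ℚ.* recip q ∣ ℚ.≤ v
  first n {u} h u≤v = begin
    ℚ.∣ seq x n ℚ.- int p ℚ.* recip q ∣     ≡⟨ cong (λ z → ℚ.∣ seq x n ℚ.- z ∣) (/≡int*recip p q) ⟨
    ℚ.∣ seq x n ℚ.- p / suc q ∣             ≤⟨ p≤p+ε _ 0<δ ⟩
    ℚ.∣ seq x n ℚ.- p / suc q ∣ ℚ.+ δ       ≤⟨ h ⟩
    u                                       ≤⟨ u≤v ⟩
    v                                       ∎
  second : ∀ n {u} → ℚ.∣ (seq (horner (coefficients P) x) n ℚ.+ seq α n) ℚ.- r / suc q ∣ ℚ.+ ε ℚ.≤ u → u ℚ.≤ v →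
           ℚ.∣ (hornerℚ (coefficients P) (seq x n) ℚ.+ seq α n) ℚ.- int r ℚ.* recip q ∣ ℚ.+ ε ℚ.≤ v
  second n {u} h u≤v = begin
    ℚ.∣ (hornerℚ (coefficients P) (seq x n) ℚ.+ seq α n) ℚ.- int r ℚ.* recip q ∣ ℚ.+ ε
      ≡⟨ cong₂ (λ f z → ℚ.∣ (f ℚ.+ seq α n) ℚ.- z ∣ ℚ.+ ε) (seq-horner (coefficients P) x n) (/≡int*recip r q) ⟨
    ℚ.∣ (seq (horner (coefficients P) x) n ℚ.+ seq α n) ℚ.- r / suc q ∣ ℚ.+ ε   ≤⟨ h ⟩
    u                                                             ≤⟨ u≤v ⟩
    v                                                             ∎

-- `Infinite` is applied to one list, which holds every approximating triple with denominator below
-- the start of block `j⁎`. The triple returned lies in that block or a later one, where 2 ^ j is at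
-- least the constants of `x` and `α`, so the ball around its residual fraction is in the block and
-- contains `α`.
W-covered : ∀ {d} (P : Polynomial (suc d)) M τ Nτ →
  (∀ n → Nτ ≤ n → nat (suc (suc d)) ℚ.+ recip M ℚ.≤ seq τ n) →
  ∀ α → ∃[ x ] W τ (shift P α) x →
  ∀ j₀ → ∃[ j ] j₀ ≤ j × ∃[ I ] I ∈ block (suc d) M j × I ∋ᴿ α
W-covered {d} P M τ Nτ D≤τ α (x , infinite) j₀ = go (infinite smallTriples)
  where
  open ℚ.≤-Reasoning

  as : Vec ℤ (suc (suc d))
  as = coefficients P

  A B R H C : ℚ
  A = proj₁ (eventually-bounded x)
  B = proj₁ (eventually-bounded α)
  -- The 1 allows for the distance from `x` to p / q, so that both points lie in the range of the
  -- Lipschitz bound.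
  R = 1ℚ ℚ.+ A
  H = hornerBound as R
  C = lipschitz as R ℚ.+ 1ℚ

  0≤A : 0ℚ ℚ.≤ A
  0≤A = ℚ.<⇒≤ (proj₁ (proj₂ (eventually-bounded x)))
  0≤B : 0ℚ ℚ.≤ B
  0≤B = ℚ.<⇒≤ (proj₁ (proj₂ (eventually-bounded α)))
  0≤1 : 0ℚ ℚ.≤ 1ℚ
  0≤1 = ℚ.<⇒≤ (ℚ.positive⁻¹ 1ℚ)
  0≤R : 0ℚ ℚ.≤ R
  0≤R = 0≤p+q 0≤1 0≤A
  A≤R : A ℚ.≤ R
  A≤R = ℚ.≤-trans (ℚ.≤-reflexive (sym (ℚ.+-identityˡ A))) (ℚ.+-monoˡ-≤ A 0≤1)
  0≤C : 0ℚ ℚ.≤ C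
  0≤C = 0≤p+q (0≤lipschitz as 0≤R) 0≤1

  K₁ K₂ K₃ K j⁎ : ℕ
  -- In absolute value, `K₁` bounds p / q, `K₂` bounds r / q, and `K₃` bounds both the constant in
  -- the radius and the centre of the ball.
  K₁ = proj₁ (≤-nat R)
  K₂ = proj₁ (≤-nat (1ℚ ℚ.+ (H ℚ.+ B)))
  K₃ = proj₁ (≤-nat (C ℚ.+ B))
  K  = K₁ ℕ.⊔ (K₂ ℕ.⊔ K₃)
  j⁎ = j₀ ℕ.⊔ K

  R≤K : R ℚ.≤ nat K
  R≤K = ℚ.≤-trans (proj₂ (≤-nat R)) (nat-mono-≤ (ℕ.m≤m⊔n K₁ (K₂ ℕ.⊔ K₃)))
  1+H+B≤K : 1ℚ ℚ.+ (H ℚ.+ B) ℚ.≤ nat K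
  1+H+B≤K = ℚ.≤-trans (proj₂ (≤-nat (1ℚ ℚ.+ (H ℚ.+ B))))
    (nat-mono-≤ (ℕ.≤-trans (ℕ.m≤m⊔n K₂ K₃) (ℕ.m≤n⊔m K₁ (K₂ ℕ.⊔ K₃))))
  C+B≤K : C ℚ.+ B ℚ.≤ nat K
  C+B≤K = ℚ.≤-trans (proj₂ (≤-nat (C ℚ.+ B)))
    (nat-mono-≤ (ℕ.≤-trans (ℕ.m≤n⊔m K₂ K₃) (ℕ.m≤n⊔m K₁ (K₂ ℕ.⊔ K₃))))
  C≤K : C ℚ.≤ nat K
  C≤K = ℚ.≤-trans (ℚ.≤-trans (ℚ.≤-reflexive (sym (ℚ.+-identityʳ C))) (ℚ.+-monoʳ-≤ C 0≤B)) C+B≤K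

  Nx Nα : ℕ
  Nx = proj₁ (proj₂ (proj₂ (eventually-bounded x)))
  Nα = proj₁ (proj₂ (proj₂ (eventually-bounded α)))
  x-bounded : ∀ n → Nx ≤ n → ℚ.∣ seq x n ∣ ℚ.≤ A
  x-bounded = proj₂ (proj₂ (proj₂ (eventually-bounded x)))
  α-bounded : ∀ n → Nα ≤ n → ℚ.∣ seq α n ∣ ℚ.≤ B
  α-bounded = proj₂ (proj₂ (proj₂ (eventually-bounded α)))

  record Bounds (p r : ℤ) (q j : ℕ) : Set where
    field
      ε     : ℚ
      0<ε   : 0ℚ ℚ.< ε
      N     : ℕ
      z≤R   : ℚ.∣ int p ℚ.* recip q ∣ ℚ.≤ R
      u≤K   : ℚ.∣ int r ℚ.* recip q ∣ ℚ.≤ nat K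
      α≤B   : ∀ n → N ≤ n → ℚ.∣ seq α n ∣ ℚ.≤ B
      close : ∀ n → N ≤ n →
        ℚ.∣ seq α n ℚ.- (int r ℚ.* recip q ℚ.- hornerℚ as (int p ℚ.* recip q)) ∣ ℚ.+ ε ℚ.≤
        C ℚ.* half ^ blockExponent (suc (suc d)) M j

  bounds : ∀ p r q j → blockStart M j ≤ suc q → Approximates τ (shift P α) x (p , r , suc q) → Bounds p r q j
  bounds p r q j Q≤q approx = record
    { ε = ε ; 0<ε = 0<ε ; N = N
    ; z≤R = z≤R
    ; u≤K = ℚ.≤-trans (∣∣-≤-via u (hornerℚ as (seq x N) ℚ.+ seq α N)
        (ℚ.≤-trans (p≤p+ε _ 0<ε) (ℚ.≤-trans (proj₂ (near N (N′≤ ℕ.≤-refl))) v≤1))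
        (ℚ.≤-trans (ℚ.∣p+q∣≤∣p∣+∣q∣ (hornerℚ as (seq x N)) (seq α N))
          (ℚ.+-mono-≤ (hornerℚ-bounded as (seq x N) 0≤R (x≤R N ℕ.≤-refl)) (α-bounded N (Nα≤ ℕ.≤-refl))))) 1+H+B≤K
    ; α≤B = λ n N≤n → α-bounded n (Nα≤ N≤n)
    ; close = λ n N≤n → residual-close as (seq x n) z (seq α n) u 0≤R (x≤R n N≤n) z≤R
        (proj₁ (near n (N′≤ N≤n))) (proj₂ (near n (N′≤ N≤n)))
    }
    where
    z u v : ℚ
    z = int p ℚ.* recip q
    u = int r ℚ.* recip q
    v = half ^ blockExponent (suc (suc d)) M j
    v≤1 : v ℚ.≤ 1ℚ
    v≤1 = half^n≤1 (blockExponent (suc (suc d)) M j)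
    ab : ∃[ ε ] 0ℚ ℚ.< ε × ∃[ N ] ∀ n → N ≤ n →
      ℚ.∣ seq x n ℚ.- z ∣ ℚ.≤ v × ℚ.∣ (hornerℚ as (seq x n) ℚ.+ seq α n) ℚ.- u ∣ ℚ.+ ε ℚ.≤ v
    ab = approximation-bounds P (suc (suc d)) M τ Nτ D≤τ x α p r q j Q≤q approx
    ε : ℚ
    ε = proj₁ ab
    0<ε : 0ℚ ℚ.< ε
    0<ε = proj₁ (proj₂ ab)
    N′ N : ℕ
    N′ = proj₁ (proj₂ (proj₂ ab))
    N  = N′ ℕ.⊔ (Nx ℕ.⊔ Nα)
    near : ∀ n → N′ ≤ n →
      ℚ.∣ seq x n ℚ.- z ∣ ℚ.≤ v × ℚ.∣ (hornerℚ as (seq x n) ℚ.+ seq α n) ℚ.- u ∣ ℚ.+ ε ℚ.≤ v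
    near = proj₂ (proj₂ (proj₂ ab))
    N′≤ : ∀ {n} → N ≤ n → N′ ≤ n
    N′≤ = ℕ.m⊔n≤o⇒m≤o N′ (Nx ℕ.⊔ Nα)
    Nα≤ : ∀ {n} → N ≤ n → Nα ≤ n
    Nα≤ h = ℕ.m⊔n≤o⇒n≤o Nx Nα (ℕ.m⊔n≤o⇒n≤o N′ (Nx ℕ.⊔ Nα) h)
    x≤A : ∀ n → N ≤ n → ℚ.∣ seq x n ∣ ℚ.≤ A
    x≤A n h = x-bounded n (ℕ.m⊔n≤o⇒m≤o Nx Nα (ℕ.m⊔n≤o⇒n≤o N′ (Nx ℕ.⊔ Nα) h))
    x≤R : ∀ n → N ≤ n → ℚ.∣ seq x n ∣ ℚ.≤ R
    x≤R n h = ℚ.≤-trans (x≤A n h) A≤R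
    z≤R : ℚ.∣ z ∣ ℚ.≤ R
    z≤R = ∣∣-≤-via z (seq x N) (ℚ.≤-trans (proj₁ (near N (N′≤ ℕ.≤-refl))) v≤1) (x≤A N ℕ.≤-refl)

  -- With q below the threshold, p and r are bounded in terms of x and α, so
  -- an approximation outside this list has a large denominator.
  threshold : ℕ
  threshold = blockStart M j⁎

  smallTriples : List Triple
  smallTriples = cartesianProduct (ints (K ℕ.* threshold))
    (cartesianProduct (ints (K ℕ.* threshold)) (upTo threshold))

  ∈-smallTriples : ∀ p r q → Approximates τ (shift P α) x (p , r , suc q) → suc q ℕ.< threshold →
                   (p , r , suc q) ∈ smallTriples
  ∈-smallTriples p r q approx q< = ∈-cartesianProduct⁺
    (∈-ints _ p (ℕ.≤-trans (fraction-numerator-≤ p q K (ℚ.≤-trans z≤R R≤K)) K*q≤))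
    (∈-cartesianProduct⁺ (∈-ints _ r (ℕ.≤-trans (fraction-numerator-≤ r q K u≤K) K*q≤)) (∈-upTo⁺ q<))
    where
    -- Block 0 starts at 1, so its bounds, with errors of at most 1, apply to every denominator.
    open Bounds (bounds p r q 0 (ℕ.s≤s ℕ.z≤n) approx)
    K*q≤ : K ℕ.* suc q ≤ K ℕ.* threshold
    K*q≤ = ℕ.*-monoʳ-≤ K (ℕ.<⇒≤ q<)

  covered : ∀ p r q j → Approximates τ (shift P α) x (p , r , suc q) → K ≤ j →
    blockStart M j ≤ suc q → suc q ℕ.< blockStart M (suc j) →
    ∃[ I ] I ∈ block (suc d) M j × I ∋ᴿ α
  covered p r q j approx K≤j Q≤q q<Q′ =
    rationalBall (suc d) M j (q , s) ,
    ∈-map⁺ (rationalBall (suc d) M j)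
      (∈-cartesianProduct⁺ (∈-upTo⁺ (ℕ.<⇒≤ q<Q′)) (∈-ints (numeratorBound (suc d) M j) s ∣s∣≤)) ,
    ball-∋ᴿ c (radius (suc d) M j) (0≤radius (suc d) M j) α ε 0<ε N
      (λ n N≤n → ℚ.≤-trans (close′ n N≤n) (*-monoʳ-≤ v 0≤v C≤2^j))
    where
    open Bounds (bounds p r q j Q≤q approx)
    s : ℤ
    s = proj₁ (residual-denominator as p r q)
    c : ℚ
    c = int s ℚ.* recip q ^ suc d
    v : ℚ
    v = half ^ blockExponent (suc (suc d)) M j
    0≤v : 0ℚ ℚ.≤ v
    0≤v = 0≤half^ (blockExponent (suc (suc d)) M j)
    K≤2^j : nat K ℚ.≤ nat (2 ℕ.^ j)
    K≤2^j = nat-mono-≤ (ℕ.≤-trans K≤j (ℕ.<⇒≤ (1+n≤2^n j)))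
    C≤2^j : C ℚ.≤ nat (2 ℕ.^ j)
    C≤2^j = ℚ.≤-trans C≤K K≤2^j
    close′ : ∀ n → N ≤ n → ℚ.∣ seq α n ℚ.- c ∣ ℚ.+ ε ℚ.≤ C ℚ.* v
    close′ n N≤n = subst (λ y → ℚ.∣ seq α n ℚ.- y ∣ ℚ.+ ε ℚ.≤ C ℚ.* v)
      (proj₂ (residual-denominator as p r q)) (close n N≤n)
    ∣c∣≤ : ℚ.∣ c ∣ ℚ.≤ nat (2 ℕ.^ j)
    ∣c∣≤ = begin
      ℚ.∣ c ∣            ≤⟨ ∣∣-≤-via c (seq α N) (ℚ.≤-trans (p≤p+ε _ 0<ε) (close′ N ℕ.≤-refl)) (α≤B N ℕ.≤-refl) ⟩
      C ℚ.* v ℚ.+ B      ≤⟨ ℚ.+-monoˡ-≤ B (*-monoˡ-≤ C 0≤C (half^n≤1 (blockExponent (suc (suc d)) M j))) ⟩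
      C ℚ.* 1ℚ ℚ.+ B     ≡⟨ cong (ℚ._+ B) (ℚ.*-identityʳ C) ⟩
      C ℚ.+ B            ≤⟨ C+B≤K ⟩
      nat K              ≤⟨ K≤2^j ⟩
      nat (2 ℕ.^ j)      ∎
    ∣s∣≤ : ℤ.∣ s ∣ ≤ numeratorBound (suc d) M j
    ∣s∣≤ = ℕ.≤-trans (numerator-≤ s q (suc d) (2 ℕ.^ j) ∣c∣≤)
      (ℕ.*-monoʳ-≤ (2 ℕ.^ j) (ℕ.^-monoˡ-≤ (suc d) (ℕ.<⇒≤ q<Q′)))

  q<blockStart : ∀ q → q ℕ.< blockStart M (j⁎ + q)
  q<blockStart q = ℕ.≤-trans (1+n≤2^n q)
    (ℕ.^-monoʳ-≤ 2 (ℕ.≤-trans (ℕ.m≤n+m q j⁎) (ℕ.m≤m*n (j⁎ + q) (period M))))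

  go : ∃[ t ] Approximates τ (shift P α) x t × t ∉ smallTriples →
       ∃[ j ] j₀ ≤ j × ∃[ I ] I ∈ block (suc d) M j × I ∋ᴿ α
  go ((p , r , suc q) , approx , new) =
    let j , j⁎≤j , Q≤q , q<Q′ = bracket (blockStart M) (suc q) j⁎ (suc q)
          (ℕ.≮⇒≥ λ q< → new (∈-smallTriples p r q approx q<)) (q<blockStart (suc q))
    in j , ℕ.≤-trans (ℕ.m≤m⊔n j₀ K) j⁎≤j ,
       covered p r q j approx (ℕ.≤-trans (ℕ.m≤n⊔m j₀ K) j⁎≤j) Q≤q q<Q′

-- The gap that witnesses the strict inequality supplies `M`; the blocks depend on τ through this
-- number alone.
exponent-gap : ∀ d τ → ι (+ (d + 1) / 1) <ᴿ τ →
  ∃[ M ] ∃[ N ] ∀ n → N ≤ n → nat (suc d) ℚ.+ recip M ℚ.≤ seq τ n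
exponent-gap d τ (ε , 0<ε , N , h) = ↧ₙ ε , N , λ n N≤n → begin
  nat (suc d) ℚ.+ recip (↧ₙ ε)      ≤⟨ ℚ.+-monoʳ-≤ (nat (suc d)) (ℚ.<⇒≤ (recip<ε 0<ε)) ⟩
  nat (suc d) ℚ.+ ε                 ≡⟨ cong (λ k → nat k ℚ.+ ε) (ℕ.+-comm d 1) ⟨
  nat (d + 1) ℚ.+ ε                 ≡⟨ cong (ℚ._+ ε) (int-def (+ (d + 1))) ⟨
  + (d + 1) / 1 ℚ.+ ε               ≤⟨ h n N≤n ⟩
  seq τ n                           ∎
  where open ℚ.≤-Reasoning

theorem1p4 : (d : ℕ) (P : Polynomial d) → 2 ≤ d →
    (τ : ℝ) → ι (+ (d + 1) / 1) <ᴿ τ →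
    AlmostAll (λ α → Empty (W τ (shift P α)))
theorem1p4 (suc d) P _ τ d+1<τ =
  let M , N , gap = exponent-gap (suc d) τ d+1<τ in
  -- The null set carries the point `x`, from which the covering interval is computed; a mere denial
  -- of emptiness would not provide it.
  (λ α → ∃[ x ] W τ (shift P α) x) ,
  borel-cantelli (block (suc d) M) (blockConstant (suc d) M) (0≤blockConstant (suc d) M) (totalWidth-block (suc d) M)
    (λ α → ∃[ x ] W τ (shift P α) x) (W-covered P M τ N gap) ,
  λ α ¬covered x x∈W → ¬covered (x , x∈W)
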